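{- Let $q$ be a prime power, let $n\geq 1$, and let $\pmb\alpha=(\alpha_1,\dots,\alpha_n)$, $\pmb\beta=(\beta_1,\dots,\beta_n)$ be parameters in $\frac1{q-1}\mathbb Z$ which are nondegenerate, i.e. $\beta_i-\alpha_i\notin\mathbb Z$ for every $i=1,\dots,n$. Let $t\in\mathbb F_q\smallsetminus\{0,1\}$. Then $$\sum_{\substack{(x_i)\in(\mathbb F_q\smallsetminus\{0,1\})^n\\ tx_1\cdots x_n=1}}\ \prod_{i=1}^n\omega^{\alpha_i}(-x_i)\,\omega^{\beta_i-\alpha_i}(1-x_i)=-H(\pmb\alpha,\pmb\beta,t).$$
   Context: Let $\omega^{1/(q-1)}$ be a fixed generator of the group of characters $\mathbb F_q^\times\to\mathbb C^\times$; for $\mu\in\frac1{q-1}\mathbb Z$ this defines the character $\omega^\mu$. Let $\Theta$ be a nontrivial additive character of $\mathbb F_q$, and for $\alpha\in\frac1{q-1}\mathbb Z$ let $g(\alpha)=\sum_{x\in\mathbb F_q^\times}\omega^\alpha(x)\Theta(x)$ be the Gauss sum. The period-normalized hypergeometric sum is $$H(\pmb\alpha,\pmb\beta,t)=\frac{ -1}{q-1}\sum_{\mu=0}^{q-2}\Bigl(\prod_{i=1}^n\frac{g(\alpha_i+\frac{\mu}{q-1})\,g(-\beta_i-\frac{\mu}{q-1})}{g(\alpha_i-\beta_i)}\Bigr)\omega^{\mu/(q-1)}((-1)^nt),\qquad t\in\mathbb F_q^\times.$$ -}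

module Defs where

open import Level using (Level; 0ℓ; _⊔_) renaming (suc to lsuc)
open import Algebra.Bundles using (CommutativeRing; Group)
import Algebra.Definitions
import Algebra.Definitions.RawMonoid as RawMonoidOps
open import Algebra.Morphism.Bundles using (GroupHomomorphism)
open import Data.Bool.Base using (if_then_else_)
open import Data.Fin.Base as Fin using (Fin; toℕ)
import Data.Fin.Properties as Fin
open import Data.Integer.Base as ℤ using (ℤ; +_; -[1+_]; -1ℤ)
open import Data.Nat.Base as ℕ using (ℕ; zero; suc; _∸_; NonZero)
open import Data.Nat.Primality using (Prime)
import Data.Nat.Properties as ℕ
open import Data.Product using (Σ; ∃₂; ∃-syntax; ∃!; _×_; _,_; proj₁; proj₂)
open import Data.Rational.Base as ℚ using (ℚ; 0ℚ; 1ℚ; _/_)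
import Data.Rational.Properties as ℚ
open import Data.Rational.Solver using (module +-*-Solver)
open import Data.Vec.Functional using ([]; _∷_)
open import Function.Base using (id)
open import Function.Bundles using (Inverse)
open import Function.Properties.Inverse using (Inverse⇒Injection)
import Function.Construct.Symmetry as Symmetry
open import Relation.Binary.PropositionalEquality as ≡ using (_≡_)
open import Relation.Nullary.Decidable using (Dec; yes; no; does; ¬?; _×-dec_; via-injection)
open import Relation.Nullary.Negation using (¬_; contradiction)
open import Relation.Unary using (Decidable)

-- |s i| becomes smaller than any ε > 0 once rank i is large enough.
Vanishes : {I : Set} → (I → ℕ) → (I → ℚ) → Set
Vanishes rank s = ∀ ε → 0ℚ ℚ.< ε → ∃[ N ] ∀ i → N ℕ.≤ rank i → ℚ.∣ s i ∣ ℚ.< ε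

-- N ≤ m ⊓ n says that both indices are at least N.
IsCauchy : (ℕ → ℚ) → Set
IsCauchy x = Vanishes {ℕ × ℕ} (λ (m , n) → m ℕ.⊓ n) (λ (m , n) → x m ℚ.- x n)

record ℝ : Set where
  constructor mkℝ
  field
    seq      : ℕ → ℚ
    isCauchy : IsCauchy seq

open ℝ public

infix 4 _≈ᴿ_

_≈ᴿ_ : ℝ → ℝ → Set
x ≈ᴿ y = Vanishes id (λ n → seq x n ℚ.- seq y n)

private
  variable
    I : Set
    rank : I → ℕ
    s u b : I → ℚ

  half+half : ∀ ε → ℚ.½ ℚ.* ε ℚ.+ ℚ.½ ℚ.* ε ≡ ε
  half+half ε = ≡.trans (≡.sym (ℚ.*-distribʳ-+ ε ℚ.½ ℚ.½)) (ℚ.*-identityˡ ε)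

  half-pos : ∀ {ε} → 0ℚ ℚ.< ε → 0ℚ ℚ.< ℚ.½ ℚ.* ε
  half-pos {ε} ε>0 =
    let instance _ = ℚ.positive ε>0 in ℚ.positive⁻¹ _ {{ℚ.pos*pos⇒pos ℚ.½ ε}}

  vanishes-cong : (∀ i → s i ≡ u i) → Vanishes rank s → Vanishes rank u
  vanishes-cong s≡u vs ε ε>0 =
    let N , h = vs ε ε>0 in
    N , λ i N≤i → ≡.subst (λ z → ℚ.∣ z ∣ ℚ.< ε) (s≡u i) (h i N≤i)

  vanishes-0 : (∀ i → s i ≡ 0ℚ) → Vanishes rank s
  vanishes-0 s≡0 ε ε>0 =
    0 , λ i _ → ≡.subst (λ z → ℚ.∣ z ∣ ℚ.< ε) (≡.sym (s≡0 i)) ε>0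

  vanishes-+ : Vanishes rank s → Vanishes rank u → Vanishes rank (λ i → s i ℚ.+ u i)
  vanishes-+ {rank = rank} {s = s} {u = u} vs vu ε ε>0 =
    let N₁ , h₁ = vs (ℚ.½ ℚ.* ε) (half-pos ε>0)
        N₂ , h₂ = vu (ℚ.½ ℚ.* ε) (half-pos ε>0)
    in  N₁ ℕ.⊔ N₂ , λ i N≤i →
        ℚ.≤-<-trans (ℚ.∣p+q∣≤∣p∣+∣q∣ (s i) (u i))
          (≡.subst (_ ℚ.<_) (half+half ε)
            (ℚ.+-mono-< (h₁ i (ℕ.≤-trans (ℕ.m≤m⊔n N₁ N₂) N≤i))
                        (h₂ i (ℕ.≤-trans (ℕ.m≤n⊔m N₁ N₂) N≤i))))

  vanishes-neg : Vanishes rank s → Vanishes rank (λ i → ℚ.- s i)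
  vanishes-neg {s = s} vs ε ε>0 =
    let N , h = vs ε ε>0 in
    N , λ i N≤i → ≡.subst (ℚ._< ε) (≡.sym (ℚ.∣-p∣≡∣p∣ (s i))) (h i N≤i)

  Bounded : (I → ℕ) → (I → ℚ) → Set
  Bounded rank b = ∃[ B ] ℚ.Positive B × ∃[ N ] ∀ i → N ℕ.≤ rank i → ℚ.∣ b i ∣ ℚ.≤ B

  vanishes-* : Bounded rank b → Vanishes rank s → Vanishes rank (λ i → b i ℚ.* s i)
  vanishes-* {b = b} {s = s} (B , B>0 , N₁ , h₁) vs ε ε>0 =
    let instance
          _ = B>0
          _ = ℚ.positive ε>0
          _ = ℚ.pos⇒nonZero B
          _ = ℚ.pos⇒nonNeg B
        δ = ℚ.1/ B ℚ.* ε
        δ>0 = ℚ.positive⁻¹ _ {{ℚ.pos*pos⇒pos (ℚ.1/ B) {{ℚ.1/pos⇒pos B}} ε}}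
        N₂ , h₂ = vs δ δ>0
        Bδ≡ε = ≡.trans (≡.sym (ℚ.*-assoc B (ℚ.1/ B) ε))
                 (≡.trans (≡.cong (ℚ._* ε) (ℚ.*-inverseʳ B)) (ℚ.*-identityˡ ε))
    in  N₁ ℕ.⊔ N₂ , λ i N≤i →
        ≡.subst₂ ℚ._<_ (≡.sym (ℚ.∣p*q∣≡∣p∣*∣q∣ (b i) (s i))) Bδ≡ε
          (ℚ.≤-<-trans
            (ℚ.*-monoʳ-≤-nonNeg ℚ.∣ s i ∣ {{ℚ.∣-∣-nonNeg (s i)}}
              (h₁ i (ℕ.≤-trans (ℕ.m≤m⊔n N₁ N₂) N≤i)))
            (ℚ.*-monoʳ-<-pos B (h₂ i (ℕ.≤-trans (ℕ.m≤n⊔m N₁ N₂) N≤i))))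

  vanishes-reindex : ∀ {J : Set} {rank′ : J → ℕ} (f : J → I) →
                     (∀ j → rank′ j ℕ.≤ rank (f j)) →
                     Vanishes rank s → Vanishes rank′ (λ j → s (f j))
  vanishes-reindex f rank≤ vs ε ε>0 =
    let N , h = vs ε ε>0 in N , λ j N≤j → h (f j) (ℕ.≤-trans N≤j (rank≤ j))

  bounded-reindex : ∀ {J : Set} {rank′ : J → ℕ} (f : J → I) →
                    (∀ j → rank′ j ℕ.≤ rank (f j)) →
                    Bounded rank b → Bounded rank′ (λ j → b (f j))
  bounded-reindex f rank≤ (B , B>0 , N , h) =
    B , B>0 , N , λ j N≤j → h (f j) (ℕ.≤-trans N≤j (rank≤ j))

  bounded : ∀ x → Bounded id (seq x)
  bounded x =
    let N , h = isCauchy x 1ℚ (ℚ.positive⁻¹ 1ℚ)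
        xN = seq x N
    in  1ℚ ℚ.+ ℚ.∣ xN ∣ , ℚ.pos+nonNeg⇒pos 1ℚ ℚ.∣ xN ∣ {{ℚ.∣-∣-nonNeg xN}} , N , λ n N≤n →
        ≡.subst (λ z → ℚ.∣ z ∣ ℚ.≤ 1ℚ ℚ.+ ℚ.∣ xN ∣)
          (solve 2 (λ a c → (a :- c) :+ c := a) ≡.refl (seq x n) xN)
          (ℚ.≤-trans (ℚ.∣p+q∣≤∣p∣+∣q∣ (seq x n ℚ.- xN) xN)
            (ℚ.+-monoˡ-≤ ℚ.∣ xN ∣ (ℚ.<⇒≤ (h (n , N) (ℕ.⊓-glb N≤n ℕ.≤-refl)))))
    where open +-*-Solver

  boundedˡ : ∀ x → Bounded (λ (m , n) → m ℕ.⊓ n) (λ ((m , n) : ℕ × ℕ) → seq x m)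
  boundedˡ x = bounded-reindex proj₁ (λ (m , n) → ℕ.m⊓n≤m m n) (bounded x)

  boundedʳ : ∀ x → Bounded (λ (m , n) → m ℕ.⊓ n) (λ ((m , n) : ℕ × ℕ) → seq x n)
  boundedʳ x = bounded-reindex proj₂ (λ (m , n) → ℕ.m⊓n≤n m n) (bounded x)

  interchange : ∀ a b c d → (a ℚ.- b) ℚ.+ (c ℚ.- d) ≡ (a ℚ.+ c) ℚ.- (b ℚ.+ d)
  interchange = solve 4 (λ a b c d → (a :- b) :+ (c :- d) := (a :+ c) :- (b :+ d)) ≡.refl
    where open +-*-Solver

  neg-sub : ∀ a b → ℚ.- (a ℚ.- b) ≡ (ℚ.- a) ℚ.- (ℚ.- b)
  neg-sub = solve 2 (λ a b → :- (a :- b) := (:- a) :- (:- b)) ≡.refl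
    where open +-*-Solver

  product-diff : ∀ a b c d → a ℚ.* (c ℚ.- d) ℚ.+ d ℚ.* (a ℚ.- b) ≡ a ℚ.* c ℚ.- b ℚ.* d
  product-diff = solve 4 (λ a b c d → a :* (c :- d) :+ d :* (a :- b) := a :* c :- b :* d) ≡.refl
    where open +-*-Solver

pointwise : ∀ {x y} → (∀ n → seq x n ≡ seq y n) → x ≈ᴿ y
pointwise {x} {y} x≡y =
  vanishes-0 λ n → ≡.trans (≡.cong (ℚ._- seq y n) (x≡y n)) (ℚ.+-inverseʳ (seq y n))

infixl 6 _+ᴿ_ _-ᴿ_
infixl 7 _*ᴿ_
infix  8 -ᴿ_

constᴿ : ℚ → ℝ
constᴿ r = mkℝ (λ _ → r) (vanishes-0 λ _ → ℚ.+-inverseʳ r)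

_+ᴿ_ : ℝ → ℝ → ℝ
x +ᴿ y = mkℝ (λ n → seq x n ℚ.+ seq y n)
  (vanishes-cong (λ (m , n) → interchange (seq x m) (seq x n) (seq y m) (seq y n))
    (vanishes-+ (isCauchy x) (isCauchy y)))

-ᴿ_ : ℝ → ℝ
-ᴿ x = mkℝ (λ n → ℚ.- seq x n)
  (vanishes-cong (λ (m , n) → neg-sub (seq x m) (seq x n)) (vanishes-neg (isCauchy x)))

_-ᴿ_ : ℝ → ℝ → ℝ
x -ᴿ y = x +ᴿ (-ᴿ y)

_*ᴿ_ : ℝ → ℝ → ℝ
x *ᴿ y = mkℝ (λ n → seq x n ℚ.* seq y n)
  (vanishes-cong (λ (m , n) → product-diff (seq x m) (seq x n) (seq y m) (seq y n))
    (vanishes-+ (vanishes-* (boundedˡ x) (isCauchy y))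
                (vanishes-* (boundedʳ y) (isCauchy x))))

≈ᴿ-refl : ∀ {x} → x ≈ᴿ x
≈ᴿ-refl {x} = pointwise {x} {x} λ _ → ≡.refl

≈ᴿ-sym : ∀ {x y} → x ≈ᴿ y → y ≈ᴿ x
≈ᴿ-sym {x} {y} x≈y = vanishes-cong (λ n → flip (seq x n) (seq y n)) (vanishes-neg x≈y)
  where
  open +-*-Solver
  flip : ∀ a b → ℚ.- (a ℚ.- b) ≡ b ℚ.- a
  flip = solve 2 (λ a b → :- (a :- b) := b :- a) ≡.refl

≈ᴿ-trans : ∀ {x y z} → x ≈ᴿ y → y ≈ᴿ z → x ≈ᴿ z
≈ᴿ-trans {x} {y} {z} x≈y y≈z =
  vanishes-cong (λ n → telescope (seq x n) (seq y n) (seq z n)) (vanishes-+ x≈y y≈z)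
  where
  open +-*-Solver
  telescope : ∀ a b c → (a ℚ.- b) ℚ.+ (b ℚ.- c) ≡ a ℚ.- c
  telescope = solve 3 (λ a b c → (a :- b) :+ (b :- c) := a :- c) ≡.refl

+ᴿ-cong : ∀ {x x′ y y′} → x ≈ᴿ x′ → y ≈ᴿ y′ → x +ᴿ y ≈ᴿ x′ +ᴿ y′
+ᴿ-cong {x} {x′} {y} {y′} x≈x′ y≈y′ =
  vanishes-cong (λ n → interchange (seq x n) (seq x′ n) (seq y n) (seq y′ n))
    (vanishes-+ x≈x′ y≈y′)

-ᴿ-cong : ∀ {x x′} → x ≈ᴿ x′ → -ᴿ x ≈ᴿ -ᴿ x′
-ᴿ-cong {x} {x′} x≈x′ =
  vanishes-cong (λ n → neg-sub (seq x n) (seq x′ n)) (vanishes-neg x≈x′)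

*ᴿ-cong : ∀ {x x′ y y′} → x ≈ᴿ x′ → y ≈ᴿ y′ → x *ᴿ y ≈ᴿ x′ *ᴿ y′
*ᴿ-cong {x} {x′} {y} {y′} x≈x′ y≈y′ =
  vanishes-cong (λ n → product-diff (seq x n) (seq x′ n) (seq y n) (seq y′ n))
    (vanishes-+ (vanishes-* (bounded x) y≈y′) (vanishes-* (bounded y′) x≈x′))

record ℂ : Set where
  constructor _+i_
  field
    re im : ℝ

open ℂ public

infix  4 _≈ᶜ_
infixl 6 _+ᶜ_
infixl 7 _*ᶜ_
infix  8 -ᶜ_

_≈ᶜ_ : ℂ → ℂ → Set
z ≈ᶜ w = re z ≈ᴿ re w × im z ≈ᴿ im w

_+ᶜ_ : ℂ → ℂ → ℂ
z +ᶜ w = (re z +ᴿ re w) +i (im z +ᴿ im w)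

-ᶜ_ : ℂ → ℂ
-ᶜ z = (-ᴿ re z) +i (-ᴿ im z)

_*ᶜ_ : ℂ → ℂ → ℂ
z *ᶜ w = (re z *ᴿ re w -ᴿ im z *ᴿ im w) +i (re z *ᴿ im w +ᴿ im z *ᴿ re w)

fromℚ : ℚ → ℂ
fromℚ r = constᴿ r +i constᴿ 0ℚ

private
  module _ where
    open +-*-Solver

    *-assoc-re : ∀ a b c d e f →
      (a ℚ.* c ℚ.+ ℚ.- (b ℚ.* d)) ℚ.* e ℚ.+ ℚ.- ((a ℚ.* d ℚ.+ b ℚ.* c) ℚ.* f) ≡
      a ℚ.* (c ℚ.* e ℚ.+ ℚ.- (d ℚ.* f)) ℚ.+ ℚ.- (b ℚ.* (c ℚ.* f ℚ.+ d ℚ.* e))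
    *-assoc-re = solve 6 (λ a b c d e f →
      (a :* c :+ :- (b :* d)) :* e :+ :- ((a :* d :+ b :* c) :* f) :=
      a :* (c :* e :+ :- (d :* f)) :+ :- (b :* (c :* f :+ d :* e))) ≡.refl

    *-assoc-im : ∀ a b c d e f →
      (a ℚ.* c ℚ.+ ℚ.- (b ℚ.* d)) ℚ.* f ℚ.+ (a ℚ.* d ℚ.+ b ℚ.* c) ℚ.* e ≡
      a ℚ.* (c ℚ.* f ℚ.+ d ℚ.* e) ℚ.+ b ℚ.* (c ℚ.* e ℚ.+ ℚ.- (d ℚ.* f))
    *-assoc-im = solve 6 (λ a b c d e f →
      (a :* c :+ :- (b :* d)) :* f :+ (a :* d :+ b :* c) :* e :=
      a :* (c :* f :+ d :* e) :+ b :* (c :* e :+ :- (d :* f))) ≡.refl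

    *-comm-re : ∀ a b c d → a ℚ.* c ℚ.+ ℚ.- (b ℚ.* d) ≡ c ℚ.* a ℚ.+ ℚ.- (d ℚ.* b)
    *-comm-re = solve 4 (λ a b c d →
      a :* c :+ :- (b :* d) := c :* a :+ :- (d :* b)) ≡.refl

    *-comm-im : ∀ a b c d → a ℚ.* d ℚ.+ b ℚ.* c ≡ c ℚ.* b ℚ.+ d ℚ.* a
    *-comm-im = solve 4 (λ a b c d →
      a :* d :+ b :* c := c :* b :+ d :* a) ≡.refl

    *-identityˡ-re : ∀ a b → 1ℚ ℚ.* a ℚ.+ ℚ.- (0ℚ ℚ.* b) ≡ a
    *-identityˡ-re = solve 2 (λ a b →
      con 1ℚ :* a :+ :- (con 0ℚ :* b) := a) ≡.refl

    *-identityˡ-im : ∀ a b → 1ℚ ℚ.* b ℚ.+ 0ℚ ℚ.* a ≡ b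
    *-identityˡ-im = solve 2 (λ a b →
      con 1ℚ :* b :+ con 0ℚ :* a := b) ≡.refl

    *-identityʳ-re : ∀ a b → a ℚ.* 1ℚ ℚ.+ ℚ.- (b ℚ.* 0ℚ) ≡ a
    *-identityʳ-re = solve 2 (λ a b →
      a :* con 1ℚ :+ :- (b :* con 0ℚ) := a) ≡.refl

    *-identityʳ-im : ∀ a b → a ℚ.* 0ℚ ℚ.+ b ℚ.* 1ℚ ≡ b
    *-identityʳ-im = solve 2 (λ a b →
      a :* con 0ℚ :+ b :* con 1ℚ := b) ≡.refl

    distribˡ-re : ∀ a b c d e f →
      a ℚ.* (c ℚ.+ e) ℚ.+ ℚ.- (b ℚ.* (d ℚ.+ f)) ≡
      (a ℚ.* c ℚ.+ ℚ.- (b ℚ.* d)) ℚ.+ (a ℚ.* e ℚ.+ ℚ.- (b ℚ.* f))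
    distribˡ-re = solve 6 (λ a b c d e f →
      a :* (c :+ e) :+ :- (b :* (d :+ f)) :=
      (a :* c :+ :- (b :* d)) :+ (a :* e :+ :- (b :* f))) ≡.refl

    distribˡ-im : ∀ a b c d e f →
      a ℚ.* (d ℚ.+ f) ℚ.+ b ℚ.* (c ℚ.+ e) ≡
      (a ℚ.* d ℚ.+ b ℚ.* c) ℚ.+ (a ℚ.* f ℚ.+ b ℚ.* e)
    distribˡ-im = solve 6 (λ a b c d e f →
      a :* (d :+ f) :+ b :* (c :+ e) :=
      (a :* d :+ b :* c) :+ (a :* f :+ b :* e)) ≡.refl

    distribʳ-re : ∀ a b c d e f →
      (c ℚ.+ e) ℚ.* a ℚ.+ ℚ.- ((d ℚ.+ f) ℚ.* b) ≡
      (c ℚ.* a ℚ.+ ℚ.- (d ℚ.* b)) ℚ.+ (e ℚ.* a ℚ.+ ℚ.- (f ℚ.* b))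
    distribʳ-re = solve 6 (λ a b c d e f →
      (c :+ e) :* a :+ :- ((d :+ f) :* b) :=
      (c :* a :+ :- (d :* b)) :+ (e :* a :+ :- (f :* b))) ≡.refl

    distribʳ-im : ∀ a b c d e f →
      (c ℚ.+ e) ℚ.* b ℚ.+ (d ℚ.+ f) ℚ.* a ≡
      (c ℚ.* b ℚ.+ d ℚ.* a) ℚ.+ (e ℚ.* b ℚ.+ f ℚ.* a)
    distribʳ-im = solve 6 (λ a b c d e f →
      (c :+ e) :* b :+ (d :+ f) :* a :=
      (c :* b :+ d :* a) :+ (e :* b :+ f :* a)) ≡.refl

  pointwiseᶜ : ∀ {z w} → (∀ n → seq (re z) n ≡ seq (re w) n) →
               (∀ n → seq (im z) n ≡ seq (im w) n) → z ≈ᶜ w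
  pointwiseᶜ {z} {w} p q = pointwise {re z} {re w} p , pointwise {im z} {im w} q

ℂ-commutativeRing : CommutativeRing 0ℓ 0ℓ
ℂ-commutativeRing = record
  { Carrier = ℂ
  ; _≈_ = _≈ᶜ_
  ; _+_ = _+ᶜ_
  ; _*_ = _*ᶜ_
  ; -_ = -ᶜ_
  ; 0# = fromℚ 0ℚ
  ; 1# = fromℚ 1ℚ
  ; isCommutativeRing = record
    { isRing = record
      { +-isAbelianGroup = record
        { isGroup = record
          { isMonoid = record
            { isSemigroup = record
              { isMagma = record
                { isEquivalence = record
                  { refl = λ {z} → ≈ᴿ-refl {re z} , ≈ᴿ-refl {im z}
                  ; sym = λ {z} {w} (p , q) →
                      ≈ᴿ-sym {re z} {re w} p , ≈ᴿ-sym {im z} {im w} q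
                  ; trans = λ {z} {w} {v} (p , q) (p′ , q′) →
                      ≈ᴿ-trans {re z} {re w} {re v} p p′ ,
                      ≈ᴿ-trans {im z} {im w} {im v} q q′
                  }
                ; ∙-cong = λ {z} {z′} {w} {w′} (p , q) (p′ , q′) →
                    +ᴿ-cong {re z} {re z′} {re w} {re w′} p p′ ,
                    +ᴿ-cong {im z} {im z′} {im w} {im w′} q q′
                }
              ; assoc = λ z w v → pointwiseᶜ {(z +ᶜ w) +ᶜ v} {z +ᶜ (w +ᶜ v)}
                  (λ n → ℚ.+-assoc (seq (re z) n) (seq (re w) n) (seq (re v) n))
                  (λ n → ℚ.+-assoc (seq (im z) n) (seq (im w) n) (seq (im v) n))
              }
            ; identity =
                (λ z → pointwiseᶜ {fromℚ 0ℚ +ᶜ z} {z}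
                  (λ n → ℚ.+-identityˡ (seq (re z) n)) (λ n → ℚ.+-identityˡ (seq (im z) n))) ,
                (λ z → pointwiseᶜ {z +ᶜ fromℚ 0ℚ} {z}
                  (λ n → ℚ.+-identityʳ (seq (re z) n)) (λ n → ℚ.+-identityʳ (seq (im z) n)))
            }
          ; inverse =
              (λ z → pointwiseᶜ {(-ᶜ z) +ᶜ z} {fromℚ 0ℚ}
                (λ n → ℚ.+-inverseˡ (seq (re z) n)) (λ n → ℚ.+-inverseˡ (seq (im z) n))) ,
              (λ z → pointwiseᶜ {z +ᶜ (-ᶜ z)} {fromℚ 0ℚ}
                (λ n → ℚ.+-inverseʳ (seq (re z) n)) (λ n → ℚ.+-inverseʳ (seq (im z) n)))
          ; ⁻¹-cong = λ {z} {w} (p , q) →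
              -ᴿ-cong {re z} {re w} p , -ᴿ-cong {im z} {im w} q
          }
        ; comm = λ z w → pointwiseᶜ {z +ᶜ w} {w +ᶜ z}
            (λ n → ℚ.+-comm (seq (re z) n) (seq (re w) n))
            (λ n → ℚ.+-comm (seq (im z) n) (seq (im w) n))
        }
      ; *-cong = λ {z} {z′} {w} {w′} (p , q) (p′ , q′) →
          +ᴿ-cong {re z *ᴿ re w} {re z′ *ᴿ re w′} { -ᴿ (im z *ᴿ im w)} { -ᴿ (im z′ *ᴿ im w′)}
            (*ᴿ-cong {re z} {re z′} {re w} {re w′} p p′)
            (-ᴿ-cong {im z *ᴿ im w} {im z′ *ᴿ im w′}
              (*ᴿ-cong {im z} {im z′} {im w} {im w′} q q′)) ,
          +ᴿ-cong {re z *ᴿ im w} {re z′ *ᴿ im w′} {im z *ᴿ re w} {im z′ *ᴿ re w′}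
            (*ᴿ-cong {re z} {re z′} {im w} {im w′} p q′)
            (*ᴿ-cong {im z} {im z′} {re w} {re w′} q p′)
      ; *-assoc = λ z w v → pointwiseᶜ {(z *ᶜ w) *ᶜ v} {z *ᶜ (w *ᶜ v)}
          (λ n → *-assoc-re (seq (re z) n) (seq (im z) n) (seq (re w) n) (seq (im w) n)
                            (seq (re v) n) (seq (im v) n))
          (λ n → *-assoc-im (seq (re z) n) (seq (im z) n) (seq (re w) n) (seq (im w) n)
                            (seq (re v) n) (seq (im v) n))
      ; *-identity =
          (λ z → pointwiseᶜ {fromℚ 1ℚ *ᶜ z} {z}
            (λ n → *-identityˡ-re (seq (re z) n) (seq (im z) n))
            (λ n → *-identityˡ-im (seq (re z) n) (seq (im z) n))) ,
          (λ z → pointwiseᶜ {z *ᶜ fromℚ 1ℚ} {z}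
            (λ n → *-identityʳ-re (seq (re z) n) (seq (im z) n))
            (λ n → *-identityʳ-im (seq (re z) n) (seq (im z) n)))
      ; distrib =
          (λ z w v → pointwiseᶜ {z *ᶜ (w +ᶜ v)} {z *ᶜ w +ᶜ z *ᶜ v}
            (λ n → distribˡ-re (seq (re z) n) (seq (im z) n) (seq (re w) n) (seq (im w) n)
                               (seq (re v) n) (seq (im v) n))
            (λ n → distribˡ-im (seq (re z) n) (seq (im z) n) (seq (re w) n) (seq (im w) n)
                               (seq (re v) n) (seq (im v) n))) ,
          (λ z w v → pointwiseᶜ {(w +ᶜ v) *ᶜ z} {w *ᶜ z +ᶜ v *ᶜ z}
            (λ n → distribʳ-re (seq (re z) n) (seq (im z) n) (seq (re w) n) (seq (im w) n)
                               (seq (re v) n) (seq (im v) n))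
            (λ n → distribʳ-im (seq (re z) n) (seq (im z) n) (seq (re w) n) (seq (im w) n)
                               (seq (re v) n) (seq (im v) n)))
      }
    ; *-comm = λ z w → pointwiseᶜ {z *ᶜ w} {w *ᶜ z}
        (λ n → *-comm-re (seq (re z) n) (seq (im z) n) (seq (re w) n) (seq (im w) n))
        (λ n → *-comm-im (seq (re z) n) (seq (im z) n) (seq (re w) n) (seq (im w) n))
    }
  }

module _ {c ℓ} (R : CommutativeRing c ℓ) where
  open CommutativeRing R
  open Algebra.Definitions _≈_ using (Invertible)

  IsUnit : Carrier → Set (c ⊔ ℓ)
  IsUnit = Invertible 1# _*_

  private
    *-isUnit : ∀ {x y} → IsUnit x → IsUnit y → IsUnit (x * y)
    *-isUnit {x} {y} (x⁻¹ , x⁻¹x≈1 , xx⁻¹≈1) (y⁻¹ , y⁻¹y≈1 , yy⁻¹≈1) =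
      y⁻¹ * x⁻¹ , cancel x⁻¹x≈1 y⁻¹y≈1 , cancel yy⁻¹≈1 xx⁻¹≈1
      where
      cancel : ∀ {a b d e} → a * b ≈ 1# → d * e ≈ 1# → (d * a) * (b * e) ≈ 1#
      cancel {a} {b} {d} {e} ab≈1 de≈1 =
        trans (*-assoc d a (b * e))
          (trans (*-congˡ (trans (sym (*-assoc a b e)) (trans (*-congʳ ab≈1) (*-identityˡ e))))
            de≈1)

  units : Group (c ⊔ ℓ) ℓ
  units = record
    { Carrier = Σ Carrier IsUnit
    ; _≈_ = λ u v → proj₁ u ≈ proj₁ v
    ; _∙_ = λ (x , x-unit) (y , y-unit) → x * y , *-isUnit x-unit y-unit
    ; ε = 1# , 1# , *-identityˡ 1# , *-identityˡ 1#
    ; _⁻¹ = λ (x , x⁻¹ , x⁻¹x≈1 , xx⁻¹≈1) → x⁻¹ , x , xx⁻¹≈1 , x⁻¹x≈1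
    ; isGroup = record
      { isMonoid = record
        { isSemigroup = record
          { isMagma = record
            { isEquivalence = record { refl = refl ; sym = sym ; trans = trans }
            ; ∙-cong = *-cong
            }
          ; assoc = λ u v w → *-assoc (proj₁ u) (proj₁ v) (proj₁ w)
          }
        ; identity = (λ u → *-identityˡ (proj₁ u)) , (λ u → *-identityʳ (proj₁ u))
        }
      ; inverse = (λ (_ , _ , x⁻¹x≈1 , _) → x⁻¹x≈1) , (λ (_ , _ , _ , xx⁻¹≈1) → xx⁻¹≈1)
      ; ⁻¹-cong = λ {u} {v} → inverse-cong u v
      }
    }
    where
    inverse-cong : (u v : Σ Carrier IsUnit) → proj₁ u ≈ proj₁ v →
                   proj₁ (proj₂ u) ≈ proj₁ (proj₂ v)
    inverse-cong (x , x⁻¹ , x⁻¹x≈1 , _) (y , y⁻¹ , _ , yy⁻¹≈1) x≈y =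
      trans (sym (*-identityʳ x⁻¹))
        (trans (*-congˡ (trans (sym yy⁻¹≈1) (*-congʳ (sym x≈y))))
          (trans (sym (*-assoc x⁻¹ x y⁻¹))
            (trans (*-congʳ x⁻¹x≈1) (*-identityˡ y⁻¹))))

module _ {c ℓ} (G : Group c ℓ) where
  open Group G
  open RawMonoidOps rawMonoid using () renaming (_×_ to _times_)

  power : Carrier → ℤ → Carrier
  power x (+ n)    = n times x
  power x -[1+ n ] = (suc n times x) ⁻¹

ℂˣ : Group 0ℓ 0ℓ
ℂˣ = units ℂ-commutativeRing

IsUnitᶜ : ℂ → Set
IsUnitᶜ = IsUnit ℂ-commutativeRing

PrimePower : ℕ → Set
PrimePower q = ∃₂ λ p k → Prime p × 1 ℕ.≤ k × q ≡ p ℕ.^ k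

record FiniteField (c ℓ : Level) (q : ℕ) : Set (lsuc (c ⊔ ℓ)) where
  field
    commutativeRing : CommutativeRing c ℓ

  open CommutativeRing commutativeRing public

  field
    0≉1         : ¬ 0# ≈ 1#
    invertible  : ∀ x → ¬ x ≈ 0# → IsUnit commutativeRing x
    enumeration : Inverse (≡.setoid (Fin q)) setoid

  open Inverse enumeration public using () renaming (to to element; from to index)

  infix 4 _≟_
  _≟_ : ∀ x y → Dec (x ≈ y)
  _≟_ = via-injection (Inverse⇒Injection (Symmetry.inverse enumeration)) Fin._≟_

  instance
    q-1-nonZero : NonZero (q ∸ 1)
    q-1-nonZero = go q element index (Inverse.strictlyInverseˡ enumeration)
      where
      go : ∀ q (f : Fin q → Carrier) (g : Carrier → Fin q) → (∀ x → f (g x) ≈ x) →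
           NonZero (q ∸ 1)
      go zero          f g fg with () ← g 0#
      go (suc (suc q)) f g fg = _
      go (suc zero)    f g fg =
        contradiction (trans (sym (fg 0#)) (trans (reflexive (≡.cong f (only (g 0#) (g 1#)))) (fg 1#))) 0≉1
        where
        only : (i j : Fin 1) → i ≡ j
        only Fin.zero Fin.zero = ≡.refl

-- An element num / N of (1/N)ℤ; see toℚ.
record Frac (N : ℕ) : Set where
  constructor _/N
  field
    num : ℤ

open Frac public

module _ {N : ℕ} where
  infixl 6 _⊕_ _⊖_
  infix  8 ⊝_

  _⊕_ : Frac N → Frac N → Frac N
  μ ⊕ ν = (num μ ℤ.+ num ν) /N

  ⊝_ : Frac N → Frac N
  ⊝ μ = (ℤ.- num μ) /N

  _⊖_ : Frac N → Frac N → Frac N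
  μ ⊖ ν = μ ⊕ (⊝ ν)

  toℚ : .{{NonZero N}} → Frac N → ℚ
  toℚ μ = num μ / N

IsInteger : ℚ → Set
IsInteger r = ∃[ z ] r ≡ z / 1

Nondegenerate : ∀ {N n} → .{{NonZero N}} → (α β : Fin n → Frac N) → Set
Nondegenerate α β = ∀ i → ¬ IsInteger (toℚ (β i) ℚ.- toℚ (α i))

sumᶜ prodᶜ : ∀ {n} → (Fin n → ℂ) → ℂ
sumᶜ  = RawMonoidOps.sum (CommutativeRing.+-rawMonoid ℂ-commutativeRing)
prodᶜ = RawMonoidOps.sum (CommutativeRing.*-rawMonoid ℂ-commutativeRing)

module Characters {c ℓ q} (F : FiniteField c ℓ q) where
  open FiniteField F

  Fˣ : Group (c ⊔ ℓ) ℓ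
  Fˣ = units commutativeRing

  MultiplicativeCharacter : Set (c ⊔ ℓ)
  MultiplicativeCharacter = GroupHomomorphism (Group.rawGroup Fˣ) (Group.rawGroup ℂˣ)

  AdditiveCharacter : Set (c ⊔ ℓ)
  AdditiveCharacter = GroupHomomorphism (Group.rawGroup +-group) (Group.rawGroup ℂˣ)

  open GroupHomomorphism using (⟦_⟧)

  -- The characters of 𝔽_q^× form a cyclic group of order q - 1, so ω generates
  -- it when each character is ω^k for exactly one residue k modulo q - 1.
  IsGenerator : MultiplicativeCharacter → Set (c ⊔ ℓ)
  IsGenerator ω = ∀ (χ : MultiplicativeCharacter) →
    ∃! _≡_ λ (k : Fin (q ∸ 1)) →
      ∀ x → Group._≈_ ℂˣ (⟦ χ ⟧ x) (power ℂˣ (⟦ ω ⟧ x) (+ toℕ k))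

  Nontrivial : AdditiveCharacter → Set c
  Nontrivial Θ = ¬ (∀ x → Group._≈_ ℂˣ (⟦ Θ ⟧ x) (Group.ε ℂˣ))

  sumOver : ∀ {p} {P : Carrier → Set p} → Decidable P → (Carrier → ℂ) → ℂ
  sumOver P? f = sumᶜ λ i →
    if does (P? (element i)) then f (element i) else fromℚ 0ℚ

  sumTuples : ∀ n → ((Fin n → Carrier) → ℂ) → ℂ
  sumTuples zero    f = f []
  sumTuples (suc n) f = sumᶜ λ i → sumTuples n λ x → f (element i ∷ x)

  sumTuplesOver : ∀ {n p} {P : (Fin n → Carrier) → Set p} → Decidable P →
                  ((Fin n → Carrier) → ℂ) → ℂ
  sumTuplesOver {n} P? f = sumTuples n λ x → if does (P? x) then f x else fromℚ 0ℚ

  prodᶠ : ∀ {n} → (Fin n → Carrier) → Carrier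
  prodᶠ = RawMonoidOps.sum *-rawMonoid

  powᶠ : Carrier → ℕ → Carrier
  powᶠ x n = RawMonoidOps._×_ *-rawMonoid n x

  OffZeroOne : Carrier → Set ℓ
  OffZeroOne x = ¬ x ≈ 0# × ¬ x ≈ 1#

  OnHypersurface : ∀ {n} → Carrier → (Fin n → Carrier) → Set ℓ
  OnHypersurface t x = (∀ i → OffZeroOne (x i)) × t * prodᶠ x ≈ 1#

  nonzero? : Decidable (λ x → ¬ x ≈ 0#)
  nonzero? x = ¬? (x ≟ 0#)

  offZeroOne? : Decidable OffZeroOne
  offZeroOne? x = ¬? (x ≟ 0#) ×-dec ¬? (x ≟ 1#)

  onHypersurface? : ∀ {n} t → Decidable (OnHypersurface {n} t)
  onHypersurface? t x = Fin.all? (λ i → offZeroOne? (x i)) ×-dec (t * prodᶠ x ≟ 1#)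

  module Sums (ω : MultiplicativeCharacter) (Θ : AdditiveCharacter) where

    -- ω stands for ω^{1/(q-1)}.  The value 0 at x = 0 only makes this total.
    ω^ : Frac (q ∸ 1) → Carrier → ℂ
    ω^ μ x with x ≟ 0#
    ... | yes _  = fromℚ 0ℚ
    ... | no x≉0 = proj₁ (power ℂˣ (⟦ ω ⟧ (x , invertible x x≉0)) (num μ))

    g : Frac (q ∸ 1) → ℂ
    g α = sumOver nonzero? λ x → ω^ α x *ᶜ proj₁ (⟦ Θ ⟧ x)

    -- ℂ has no total inversion: u supplies the inverses of the denominators
    -- g(αᵢ - βᵢ).  They are unique, so the value does not depend on u.
    H : ∀ {n} (α β : Fin n → Frac (q ∸ 1)) → (∀ i → IsUnitᶜ (g (α i ⊖ β i))) →
        Carrier → ℂ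
    H {n} α β u t =
      fromℚ (-1ℤ / (q ∸ 1)) *ᶜ sumᶜ λ (m : Fin (q ∸ 1)) →
        let μ = (+ toℕ m) /N in
        prodᶜ (λ i → g (α i ⊕ μ) *ᶜ g (⊝ β i ⊖ μ) *ᶜ proj₁ (u i))
          *ᶜ ω^ μ (powᶠ (- 1#) n * t)

{-# OPTIONS --safe #-}

-- Substituting x = -wy in g(α + μ) g(-β - μ) and pulling a scalar out of the Gauss sum of the
-- nontrivial character ω^{α-β} gives
--   g(α + μ) g(-β - μ) / g(α - β) = Σ_w ω^μ(-w) ω^α(-w) ω^{β-α}(1 - w).
-- Multiplying these out and summing over μ leaves Σ_μ ω^μ(t x₁⋯xₙ), which is q - 1 on the
-- hypersurface and 0 elsewhere; where some xᵢ is 0 or 1 the integrand vanishes.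
--
-- Orthogonality has to be obtained without deciding equality in ℂ.  A character sum S over a
-- group of order n satisfies S² = nS, so S / n is idempotent; idempotents of ℂ
-- can be decided to be 0 or 1, and S = n forces the character to be trivial.  That ω separates
-- points follows by counting: the sums Σ_μ ω^μ(z) are each 0 or q - 1 and add up to q - 1.
module Submission where

open import Defs
open import Data.Fin.Base using (Fin)
open import Data.Nat.Base using (ℕ; _∸_; _≤_)
open import Data.Product.Base using (Σ)
open import Level using (Level)
open import Relation.Nullary.Negation using (¬_)

open import Algebra.Bundles using (AbelianGroup; CommutativeRing; Group)
import Algebra.Definitions.RawMonoid as RawMonoidOps
open import Algebra.Morphism.Bundles using (GroupHomomorphism)
import Algebra.Properties.AbelianGroup as AbelianGroupProperties
import Algebra.Properties.CommutativeMonoid.Mult as CommutativeMonoidMult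
import Algebra.Properties.CommutativeMonoid.Sum as CommutativeMonoidSum
import Algebra.Properties.CommutativeSemigroup as CommutativeSemigroupProperties
import Algebra.Properties.Ring as RingProperties
import Algebra.Properties.Semiring.Mult as SemiringMult
import Algebra.Properties.Semiring.Sum as SemiringSum
import Algebra.Solver.CommutativeMonoid as CommutativeMonoidSolver
open import Data.Bool.Base using (if_then_else_)
open import Data.Fin.Base as Fin using (toℕ; fromℕ; fromℕ<; inject₁; punchIn; punchOut)
open import Data.Fin.Permutation using (Permutation; permutation)
import Data.Fin.Properties as Fin
open import Data.Integer.Base as ℤ using (ℤ; +_; -[1+_]; -1ℤ)
import Data.Integer.DivMod as ℤ
import Data.Integer.Properties as ℤ
open import Data.Integer.Tactic.RingSolver using (solve-∀)
open import Data.Nat.Base as ℕ using (zero; suc; NonZero)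
import Data.Nat.Properties as ℕ
open import Data.Product using (∃!)
open import Data.Product.Base using (_×_; _,_; proj₁; proj₂; ∃-syntax)
open import Data.Rational.Base as ℚ using (ℚ; 0ℚ; 1ℚ; ½; _/_)
import Data.Rational.Properties as ℚ
open import Data.Rational.Solver using (module +-*-Solver)
open import Data.Rational.Unnormalised.Base using (mkℚᵘ; *≡*)
import Data.Rational.Unnormalised.Properties as ℚᵘ
open import Data.Sum.Base using (_⊎_; inj₁; inj₂; [_,_]′)
open import Data.Vec.Functional using ([]; _∷_; removeAt)
open import Function.Base using (const; _∘_)
open import Function.Bundles using (Inverse)
open import Level using (_⊔_)
open import Relation.Binary.PropositionalEquality as ≡ using (_≡_; _≢_)
import Relation.Binary.Reasoning.Setoid as SetoidReasoning
open import Relation.Nullary.Decidable using (Dec; yes; no; does; toSum; decidable-stable; from-yes)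
open import Relation.Nullary.Negation using (contradiction)

-- Nontriviality of a character is a bare negation here, so no point where it differs from 1 is at
-- hand, and the classical argument (multiply the sum by such a value, then cancel) cannot start;
-- the dichotomy for idempotents replaces it. Gauss sums are inverted by Fourier inversion on the
-- field rather than through |g|² = q. Nondegeneracy enters twice, each time as nontriviality of
-- ω^{α-β}: it makes the denominators invertible, and it makes Σ_y ω^{α-β}(y) vanish, which is what
-- pulling out the scalar 1 - w requires at w = 1. All of this takes place over a commutative ring
-- `K` with the few properties in `IsScalarRing`; Cauchy sequences appear only where ℂ is shown to
-- have these properties.

-- Removing both entries leaves 2 plus a natural number. This excludes a second point with nonzero
-- dual sum in the counting argument.
two-ones⇒sum≢1 : ∀ {n} (t : Fin n → ℕ) {i j} → i ≢ j → t i ≡ 1 → t j ≡ 1 →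
                 CommutativeMonoidSum.sum ℕ.+-0-commutativeMonoid t ≢ 1
two-ones⇒sum≢1 {suc (suc n)} t {i} {j} i≢j tᵢ≡1 tⱼ≡1 sum≡1 =
  ℕ.1+n≢0 (ℕ.suc-injective (≡.trans (≡.sym split) sum≡1))
  where
  open CommutativeMonoidSum ℕ.+-0-commutativeMonoid
  k : Fin (suc n)
  k = punchOut i≢j
  split : sum t ≡ suc (suc (sum (removeAt (removeAt t i) k)))
  split = ≡.trans (sum-remove {i = i} t) (≡.cong₂ ℕ._+_ tᵢ≡1
    (≡.trans (sum-remove {i = k} (removeAt t i))
      (≡.cong (ℕ._+ sum (removeAt (removeAt t i) k)) (≡.trans (≡.cong t (Fin.punchIn-punchOut i≢j)) tⱼ≡1))))
two-ones⇒sum≢1 {suc zero} t {Fin.zero} {Fin.zero} i≢j _ _ _ = i≢j ≡.refl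

-- Scalar rings: idempotents and division by positive integers

-- The properties of ℂ on which the argument rests; `idempotent` stands in for decidable equality.
-- The reciprocal carries a sign so that at ℂ it is literally the prefactor -1/(q-1) of `H`.
record IsScalarRing {k ℓk} (K : CommutativeRing k ℓk) : Set (k ⊔ ℓk) where
  open CommutativeRing K
  open SemiringMult semiring using () renaming (_×_ to _·_)
  field
    1≉0        : ¬ 1# ≈ 0#
    idempotent : ∀ e → e * e ≈ e → e ≈ 0# ⊎ e ≈ 1#
    -1/        : ∀ n → .{{NonZero n}} → Carrier
    -1/-*      : ∀ n → .{{_ : NonZero n}} → -1/ n * (n · 1#) ≈ - 1#

module ScalarRing {k ℓk} {K : CommutativeRing k ℓk} (scalar : IsScalarRing K) where
  open CommutativeRing K
  open IsScalarRing scalar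
  open SemiringMult semiring renaming (_×_ to _·_)
  open SemiringSum semiring
  open RingProperties ring
  open SetoidReasoning setoid

  1/ : ∀ n → .{{NonZero n}} → Carrier
  1/ n = - (-1/ n)

  1/-* : ∀ n .{{_ : NonZero n}} → 1/ n * (n · 1#) ≈ 1#
  1/-* n = begin
    1/ n * (n · 1#)        ≈⟨ -‿distribˡ-* _ _ ⟨
    - (-1/ n * (n · 1#))   ≈⟨ -‿cong (-1/-* n) ⟩
    - - 1#                 ≈⟨ -‿involutive 1# ⟩
    1#                     ∎

  ·-as-* : ∀ n x → n · x ≈ (n · 1#) * x
  ·-as-* n x = sym (trans (×-assoc-* n 1# x) (×-congʳ n (*-identityˡ x)))

  ·1-cancelʳ : ∀ n .{{_ : NonZero n}} {x y} → x * (n · 1#) ≈ y * (n · 1#) → x ≈ y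
  ·1-cancelʳ n {x} {y} eq = begin
    x                        ≈⟨ expand x ⟨
    x * (n · 1#) * 1/ n      ≈⟨ *-congʳ eq ⟩
    y * (n · 1#) * 1/ n      ≈⟨ expand y ⟩
    y                        ∎
    where
    expand : ∀ z → z * (n · 1#) * 1/ n ≈ z
    expand z = trans (*-assoc _ _ _)
      (trans (*-congˡ (trans (*-comm _ _) (1/-* n))) (*-identityʳ z))

  -- Divisibility forces characteristic zero: from (m + 2)·1 = 1 follows (m + 1)·1 = 0, although (m
  -- + 1)·1 is invertible.
  ·1≈1⇒≡1 : ∀ m → m · 1# ≈ 1# → m ≡ 1
  ·1≈1⇒≡1 zero          0≈1 = contradiction (sym 0≈1) 1≉0
  ·1≈1⇒≡1 (suc zero)    _   = ≡.refl
  ·1≈1⇒≡1 (suc (suc m)) eq  = contradiction 1≈0 1≉0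
    where
    m+1≈0 : suc m · 1# ≈ 0#
    m+1≈0 = +-cancelˡ 1# _ _ (trans eq (sym (+-identityʳ 1#)))
    1≈0 : 1# ≈ 0#
    1≈0 = trans (sym (1/-* (suc m))) (trans (*-congˡ m+1≈0) (zeroʳ _))

  -- S / n is idempotent.
  quasi-idempotent : ∀ n .{{_ : NonZero n}} {S} → S * S ≈ n · S → S ≈ 0# ⊎ S ≈ n · 1#
  quasi-idempotent n {S} SS≈nS = [ inj₁ ∘ vanish , inj₂ ∘ full ]′ (idempotent (1/ n * S) e-idem)
    where
    open CommutativeMonoidSolver *-commutativeMonoid renaming (_⊕_ to _⊗_)
    e-idem : (1/ n * S) * (1/ n * S) ≈ 1/ n * S
    e-idem = begin
      (1/ n * S) * (1/ n * S)         ≈⟨ solve 2 (λ a s → (a ⊗ s) ⊗ (a ⊗ s) ⊜ (a ⊗ a) ⊗ (s ⊗ s))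
                                           refl (1/ n) S ⟩
      1/ n * 1/ n * (S * S)           ≈⟨ *-congˡ (trans SS≈nS (·-as-* n S)) ⟩
      1/ n * 1/ n * ((n · 1#) * S)    ≈⟨ solve 3 (λ a b s → (a ⊗ a) ⊗ (b ⊗ s) ⊜ (a ⊗ b) ⊗ (a ⊗ s))
                                           refl (1/ n) (n · 1#) S ⟩
      1/ n * (n · 1#) * (1/ n * S)    ≈⟨ *-congʳ (1/-* n) ⟩
      1# * (1/ n * S)                 ≈⟨ *-identityˡ _ ⟩
      1/ n * S                        ∎
    S≈en : S ≈ (1/ n * S) * (n · 1#)
    S≈en = begin
      S                        ≈⟨ *-identityˡ S ⟨
      1# * S                   ≈⟨ *-congʳ (1/-* n) ⟨
      1/ n * (n · 1#) * S      ≈⟨ solve 3 (λ a b s → (a ⊗ b) ⊗ s ⊜ (a ⊗ s) ⊗ b)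
                                    refl (1/ n) (n · 1#) S ⟩
      (1/ n * S) * (n · 1#)    ∎
    vanish : 1/ n * S ≈ 0# → S ≈ 0#
    vanish e≈0 = trans S≈en (trans (*-congʳ e≈0) (zeroˡ _))
    full : 1/ n * S ≈ 1# → S ≈ n · 1#
    full e≈1 = trans S≈en (trans (*-congʳ e≈1) (*-identityˡ _))

  -- Here y is a value of the character and S its sum, which absorbs y; since n·1 can be cancelled,
  -- y must be 1.
  stabilizer-trivial : ∀ n .{{_ : NonZero n}} {S y} → S ≈ n · 1# → y * S ≈ S → y ≈ 1#
  stabilizer-trivial n {S} {y} S≈n yS≈S = ·1-cancelʳ n (begin
    y * (n · 1#)    ≈⟨ *-congˡ S≈n ⟨
    y * S           ≈⟨ yS≈S ⟩
    S               ≈⟨ S≈n ⟩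
    n · 1#          ≈⟨ *-identityˡ _ ⟨
    1# * (n · 1#)   ∎)

  sum-delta : ∀ {n} (t : Fin n → Carrier) i → (∀ j → j ≢ i → t j ≈ 0#) → sum t ≈ t i
  sum-delta {suc n} t i off = begin
    sum t                      ≈⟨ sum-remove {i = i} t ⟩
    t i + sum (removeAt t i)   ≈⟨ +-congˡ (sum-cong-≋ λ j → off (punchIn i j) (Fin.punchInᵢ≢i i j)) ⟩
    t i + sum {n} (λ _ → 0#)   ≈⟨ +-congˡ (sum-replicate-zero n) ⟩
    t i + 0#                   ≈⟨ +-identityʳ _ ⟩
    t i                        ∎

  sum-0 : ∀ {n} {t : Fin n → Carrier} → (∀ i → t i ≈ 0#) → sum t ≈ 0#
  sum-0 {n} t≈0 = trans (sum-cong-≋ t≈0) (sum-replicate-zero n)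

  -- Both sides are b 0 + ... + b n. For a sequence with b n = b 0 this is invariance under a cyclic
  -- shift.
  sum-shift : ∀ (b : ℕ → Carrier) n →
              b 0 + sum {n} (λ i → b (suc (toℕ i))) ≈ sum {n} (λ i → b (toℕ i)) + b n
  sum-shift b n = begin
    b 0 + sum {n} (λ i → b (suc (toℕ i)))
      ≈⟨ sum-init-last {n} (λ i → b (toℕ i)) ⟩
    sum {n} (λ i → b (toℕ (inject₁ i))) + b (toℕ (fromℕ n))
      ≈⟨ +-cong (sum-cong-≋ {n} λ i → reflexive (≡.cong b (Fin.toℕ-inject₁ i)))
                (reflexive (≡.cong b (Fin.toℕ-fromℕ n))) ⟩
    sum {n} (λ i → b (toℕ i)) + b n ∎

  sum-· : ∀ {n} (e : Fin n → ℕ) x →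
          sum (λ i → e i · x) ≈ CommutativeMonoidSum.sum ℕ.+-0-commutativeMonoid e · x
  sum-· {zero}  e x = refl
  sum-· {suc n} e x = trans (+-congˡ (sum-· (e ∘ Fin.suc) x)) (sym (×-homo-+ x (e Fin.zero) _))

  if-dec : ∀ {p} {P : Set p} (P? : Dec P) {x y} → (P → x ≈ y) → (¬ P → 0# ≈ y) →
           (if does P? then x else 0#) ≈ y
  if-dec (yes p) x≈y _   = x≈y p
  if-dec (no ¬p) _   0≈y = 0≈y ¬p

-- Sums over a finite field and changes of variable

module FieldSums {k ℓk c ℓ q} {K : CommutativeRing k ℓk} (scalar : IsScalarRing K)
                 (F : FiniteField c ℓ q) where
  open CommutativeRing K
  open ScalarRing scalar
  open SemiringSum semiring
  open SemiringMult semiring using () renaming (_×_ to _·_)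
  open SetoidReasoning setoid
  module F where
    open FiniteField F public
    open RingProperties (CommutativeRing.ring (FiniteField.commutativeRing F)) public

  instance
    q-nonZero : NonZero q
    q-nonZero = ℕ.≢-nonZero λ q≡0 → ℕ.≢-nonZero⁻¹ (q ∸ 1) (≡.cong (_∸ 1) q≡0)

  -- The enumeration hits a given point only up to `F.≈`, so picking out a term or changing
  -- variables requires a summand that respects it.
  Congruent : (F.Carrier → Carrier) → Set (c ⊔ ℓ ⊔ ℓk)
  Congruent f = ∀ {x y} → x F.≈ y → f x ≈ f y

  -- Opaque, so that f can be inferred from ∑ᶠ f.
  opaque
    ∑ᶠ : (F.Carrier → Carrier) → Carrier
    ∑ᶠ f = sum λ i → f (F.element i)

    ∑ᶠ≡sum : ∀ f → ∑ᶠ f ≡ sum λ i → f (F.element i)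
    ∑ᶠ≡sum f = ≡.refl

    ∑ᶠ-cong : ∀ {f h} → (∀ x → f x ≈ h x) → ∑ᶠ f ≈ ∑ᶠ h
    ∑ᶠ-cong f≈h = sum-cong-≋ {q} λ i → f≈h (F.element i)

    ∑ᶠ-*ˡ : ∀ a f → a * ∑ᶠ f ≈ ∑ᶠ (λ x → a * f x)
    ∑ᶠ-*ˡ a f = *-distribˡ-sum a (λ i → f (F.element i))

    ∑ᶠ-*ʳ : ∀ a f → ∑ᶠ f * a ≈ ∑ᶠ (λ x → f x * a)
    ∑ᶠ-*ʳ a f = *-distribʳ-sum a (λ i → f (F.element i))

    ∑ᶠ-+ : ∀ f h → ∑ᶠ (λ x → f x + h x) ≈ ∑ᶠ f + ∑ᶠ h
    ∑ᶠ-+ f h = ∑-distrib-+ (λ i → f (F.element i)) (λ i → h (F.element i))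

    ∑ᶠ-swap : ∀ (f : F.Carrier → F.Carrier → Carrier) →
              ∑ᶠ (λ x → ∑ᶠ (f x)) ≈ ∑ᶠ (λ y → ∑ᶠ (λ x → f x y))
    ∑ᶠ-swap f = ∑-comm λ i j → f (F.element i) (F.element j)

    ∑ᶠ-sum-swap : ∀ {n} (f : F.Carrier → Fin n → Carrier) →
                  ∑ᶠ (λ x → sum (f x)) ≈ sum (λ k → ∑ᶠ (λ x → f x k))
    ∑ᶠ-sum-swap f = ∑-comm λ i → f (F.element i)

    ∑ᶠ-const : ∀ a → ∑ᶠ (λ _ → a) ≈ q · a
    ∑ᶠ-const a = sum-replicate q

  ∑ᶠ-0 : ∀ {f} → (∀ x → f x ≈ 0#) → ∑ᶠ f ≈ 0#
  ∑ᶠ-0 f≈0 = trans (∑ᶠ-cong f≈0) (trans (∑ᶠ-const 0#) (×-zeroʳ q))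
    where
    ×-zeroʳ : ∀ n → n · 0# ≈ 0#
    ×-zeroʳ n = trans (·-as-* n 0#) (zeroʳ _)

  open Inverse F.enumeration public using ()
    renaming (strictlyInverseˡ to element-index; strictlyInverseʳ to index-element;
              from-cong to index-cong)

  ∑ᶠ-delta : ∀ {f} → Congruent f → ∀ a → (∀ x → ¬ x F.≈ a → f x ≈ 0#) → ∑ᶠ f ≈ f a
  ∑ᶠ-delta {f} f-cong a off = trans (reflexive (∑ᶠ≡sum f)) (trans
    (sum-delta _ (F.index a) λ j j≢ →
      off _ λ eq → j≢ (≡.trans (≡.sym (index-element j)) (index-cong eq)))
    (f-cong (element-index a)))

  -- Conjugation with the enumeration turns the bijection σ of the field into a permutation of
  -- `Fin q`.
  ∑ᶠ-reindex : ∀ {f} → Congruent f → (σ τ : F.Carrier → F.Carrier) →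
               (∀ {x y} → x F.≈ y → σ x F.≈ σ y) → (∀ {x y} → x F.≈ y → τ x F.≈ τ y) →
               (∀ x → σ (τ x) F.≈ x) → (∀ x → τ (σ x) F.≈ x) →
               ∑ᶠ f ≈ ∑ᶠ (λ x → f (σ x))
  ∑ᶠ-reindex {f} f-cong σ τ σ-cong τ-cong στ τσ = begin
    ∑ᶠ f                                         ≡⟨ ∑ᶠ≡sum f ⟩
    sum (λ i → f (F.element i))                  ≈⟨ sum-permute (λ i → f (F.element i)) π ⟩
    sum (λ i → f (F.element (F.index (σ (F.element i)))))
      ≈⟨ sum-cong-≋ {q} (λ i → f-cong (element-index (σ (F.element i)))) ⟩
    sum (λ i → f (σ (F.element i)))              ≡⟨ ∑ᶠ≡sum (λ x → f (σ x)) ⟨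
    ∑ᶠ (λ x → f (σ x))                           ∎
    where
    conj : ∀ {ρ υ : F.Carrier → F.Carrier} → (∀ {x y} → x F.≈ y → ρ x F.≈ ρ y) →
           (∀ x → ρ (υ x) F.≈ x) →
           ∀ i → F.index (ρ (F.element (F.index (υ (F.element i))))) ≡ i
    conj ρ-cong ρυ i = ≡.trans
      (index-cong (F.trans (ρ-cong (element-index _)) (ρυ (F.element i)))) (index-element i)
    π : Permutation q q
    π = permutation (λ i → F.index (σ (F.element i))) (λ i → F.index (τ (F.element i)))
          (conj {σ} {τ} σ-cong στ) (conj {τ} {σ} τ-cong τσ)

  ∑ᶠ-translate : ∀ {f} → Congruent f → ∀ y → ∑ᶠ f ≈ ∑ᶠ (λ x → f (y F.+ x))
  ∑ᶠ-translate f-cong y = ∑ᶠ-reindex f-cong (y F.+_) ((F.- y) F.+_) F.+-congˡ F.+-congˡ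
    (cancel y (F.- y) (F.-‿inverseʳ y)) (cancel (F.- y) y (F.-‿inverseˡ y))
    where
    cancel : ∀ a b → a F.+ b F.≈ F.0# → ∀ x → a F.+ (b F.+ x) F.≈ x
    cancel a b eq x = F.trans (F.sym (F.+-assoc a b x)) (F.trans (F.+-congʳ eq) (F.+-identityˡ x))

  ∑ᶠ-negate : ∀ {f} → Congruent f → ∑ᶠ f ≈ ∑ᶠ (λ x → f (F.- x))
  ∑ᶠ-negate f-cong = ∑ᶠ-reindex f-cong (F.-_) (F.-_) F.-‿cong F.-‿cong
    F.-‿involutive F.-‿involutive

  ∑ᶠ-scale : ∀ {f} → Congruent f → ∀ {y} → ¬ y F.≈ F.0# → ∑ᶠ f ≈ ∑ᶠ (λ x → f (y F.* x))
  ∑ᶠ-scale f-cong {y} y≉0 with y⁻¹ , y⁻¹y≈1 , yy⁻¹≈1 ← F.invertible y y≉0 =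
    ∑ᶠ-reindex f-cong (y F.*_) (y⁻¹ F.*_) F.*-congˡ F.*-congˡ
      (cancel y y⁻¹ yy⁻¹≈1) (cancel y⁻¹ y y⁻¹y≈1)
    where
    cancel : ∀ a b → a F.* b F.≈ F.1# → ∀ x → a F.* (b F.* x) F.≈ x
    cancel a b eq x = F.trans (F.sym (F.*-assoc a b x)) (F.trans (F.*-congʳ eq) (F.*-identityˡ x))

-- Orthogonality of multiplicative characters

-- W i stands for ω^{i/(q-1)}, extended by zero to 0.
record IsCharacterFamily {k ℓk c ℓ q} (K : CommutativeRing k ℓk) (F : FiniteField c ℓ q)
    (W : ℤ → FiniteField.Carrier F → CommutativeRing.Carrier K) : Set (ℓk ⊔ c ⊔ ℓ) where
  open CommutativeRing K
  private module F = FiniteField F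
  field
    W-cong     : ∀ i {x y} → x F.≈ y → W i x ≈ W i y
    W-at-0     : ∀ i → W i F.0# ≈ 0#
    W-*        : ∀ i x y → W i (x F.* y) ≈ W i x * W i y
    W-+        : ∀ i j x → W (i ℤ.+ j) x ≈ W i x * W j x
    W-0        : ∀ x → ¬ x F.≈ F.0# → W (+ 0) x ≈ 1#
    W-period   : ∀ x → ¬ x F.≈ F.0# → W (+ (q ∸ 1)) x ≈ 1#
    W-faithful : ∀ (k : Fin (q ∸ 1)) → (∀ x → ¬ x F.≈ F.0# → W (+ toℕ k) x ≈ 1#) → toℕ k ≡ 0

module MultiplicativeCharacters {k ℓk c ℓ q} {K : CommutativeRing k ℓk}
    (scalar : IsScalarRing K) {F : FiniteField c ℓ q}
    {W : ℤ → FiniteField.Carrier F → CommutativeRing.Carrier K}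
    (family : IsCharacterFamily K F W) where
  open CommutativeRing K
  open IsScalarRing scalar
  open ScalarRing scalar
  open SemiringSum semiring
  open SemiringMult semiring renaming (_×_ to _·_)
  open RingProperties ring
  open FieldSums scalar F
  open IsCharacterFamily family
  open SetoidReasoning setoid

  N : ℕ
  N = q ∸ 1

  W-≈0 : ∀ i {x} → x F.≈ F.0# → W i x ≈ 0#
  W-≈0 i x≈0 = trans (W-cong i x≈0) (W-at-0 i)

  W-inverse : ∀ i {x} → ¬ x F.≈ F.0# → W (ℤ.- i) x * W i x ≈ 1#
  W-inverse i {x} x≉0 = begin
    W (ℤ.- i) x * W i x   ≈⟨ W-+ (ℤ.- i) i x ⟨
    W (ℤ.- i ℤ.+ i) x     ≈⟨ reflexive (≡.cong (λ j → W j x) (ℤ.+-inverseˡ i)) ⟩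
    W (+ 0) x             ≈⟨ W-0 x x≉0 ⟩
    1#                    ∎

  W-at-1 : ∀ i → W i F.1# ≈ 1#
  W-at-1 i = begin
    w                              ≈⟨ *-identityˡ w ⟨
    1# * w                         ≈⟨ *-congʳ (W-inverse i 1≉0ᶠ) ⟨
    W (ℤ.- i) F.1# * w * w         ≈⟨ *-assoc _ w w ⟩
    W (ℤ.- i) F.1# * (w * w)       ≈⟨ *-congˡ (W-* i F.1# F.1#) ⟨
    W (ℤ.- i) F.1# * W i (F.1# F.* F.1#)
                                   ≈⟨ *-congˡ (W-cong i (F.*-identityˡ F.1#)) ⟩
    W (ℤ.- i) F.1# * w             ≈⟨ W-inverse i 1≉0ᶠ ⟩
    1#                             ∎
    where
    w = W i F.1#
    1≉0ᶠ : ¬ F.1# F.≈ F.0#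
    1≉0ᶠ eq = F.0≉1 (F.sym eq)

  -- `W (+ 0)` is the indicator of the nonzero points; adding the indicator δ of 0 gives the
  -- constant 1, whose sum is q = N + 1.
  ∑-trivial : ∑ᶠ (W (+ 0)) ≈ N · 1#
  ∑-trivial = +-cancelʳ 1# _ _ (begin
    ∑ᶠ (W (+ 0)) + 1#              ≈⟨ +-congˡ δ-sum ⟨
    ∑ᶠ (W (+ 0)) + ∑ᶠ δ            ≈⟨ ∑ᶠ-+ _ _ ⟨
    ∑ᶠ (λ x → W (+ 0) x + δ x)     ≈⟨ ∑ᶠ-cong partition ⟩
    ∑ᶠ (λ _ → 1#)                  ≈⟨ ∑ᶠ-const 1# ⟩
    q · 1#                         ≈⟨ ×-congˡ (≡.sym (ℕ.suc-pred q)) ⟩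
    1# + N · 1#                    ≈⟨ +-comm _ _ ⟩
    N · 1# + 1#                    ∎)
    where
    δ : F.Carrier → Carrier
    δ x = if does (x F.≟ F.0#) then 1# else 0#
    δ-0 : ∀ {x} → x F.≈ F.0# → δ x ≈ 1#
    δ-0 {x} x≈0 = if-dec (x F.≟ F.0#) (λ _ → refl) (contradiction x≈0)
    δ-≉0 : ∀ x → ¬ x F.≈ F.0# → δ x ≈ 0#
    δ-≉0 x x≉0 = if-dec (x F.≟ F.0#) (λ x≈0 → contradiction x≈0 x≉0) (λ _ → refl)
    δ-cong : Congruent δ
    δ-cong {x} {y} x≈y = if-dec (x F.≟ F.0#)
      (λ x≈0 → sym (δ-0 (F.trans (F.sym x≈y) x≈0)))
      (λ x≉0 → sym (δ-≉0 y (λ y≈0 → x≉0 (F.trans x≈y y≈0))))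
    δ-sum : ∑ᶠ δ ≈ 1#
    δ-sum = trans (∑ᶠ-delta δ-cong F.0# δ-≉0) (δ-0 F.refl)
    partition : ∀ x → W (+ 0) x + δ x ≈ 1#
    partition x =
      [ (λ x≈0 → trans (+-cong (W-≈0 (+ 0) x≈0) (δ-0 x≈0)) (+-identityˡ 1#))
      , (λ x≉0 → trans (+-cong (W-0 x x≉0) (δ-≉0 x x≉0)) (+-identityʳ 1#))
      ]′ (toSum (x F.≟ F.0#))

  Trivial : ℤ → Set _
  Trivial i = ∀ x → ¬ x F.≈ F.0# → W i x ≈ 1#

  Trivial-neg : ∀ i → Trivial i → Trivial (ℤ.- i)
  Trivial-neg i trivial x x≉0 = begin
    W (ℤ.- i) x                        ≈⟨ *-identityʳ _ ⟨
    W (ℤ.- i) x * 1#                   ≈⟨ *-congˡ (trivial x x≉0) ⟨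
    W (ℤ.- i) x * W i x                ≈⟨ W-inverse i x≉0 ⟩
    1#                                 ∎

  Trivial-+multiple : ∀ n → Trivial (+ n ℤ.* + N)
  Trivial-+multiple zero    = W-0
  Trivial-+multiple (suc n) x x≉0 = begin
    W (+ suc n ℤ.* + N) x              ≡⟨ ≡.cong (λ i → W i x) (ℤ.suc-* (+ n) (+ N)) ⟩
    W (+ N ℤ.+ + n ℤ.* + N) x          ≈⟨ W-+ (+ N) _ x ⟩
    W (+ N) x * W (+ n ℤ.* + N) x      ≈⟨ *-cong (W-period x x≉0) (Trivial-+multiple n x x≉0) ⟩
    1# * 1#                            ≈⟨ *-identityˡ 1# ⟩
    1#                                 ∎

  Trivial-multiple : ∀ d → Trivial (d ℤ.* + N)
  Trivial-multiple (+ n)    = Trivial-+multiple n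
  Trivial-multiple -[1+ n ] = ≡.subst Trivial (ℤ.neg-distribˡ-* (+ suc n) (+ N))
    (Trivial-neg (+ suc n ℤ.* + N) (Trivial-+multiple (suc n)))

  -- Division by N leaves an exponent r < N with the same character, and `W-faithful` makes r zero.
  -- Through the contrapositive, nondegenerate parameters yield nontrivial characters.
  Trivial⇒multiple : ∀ i → Trivial i → ∃[ d ] i ≡ d ℤ.* + N
  Trivial⇒multiple i trivial =
    d , ≡.trans i≡r+dN (≡.trans (≡.cong (λ m → + m ℤ.+ d ℤ.* + N) r≡0) (ℤ.+-identityˡ _))
    where
    r = i ℤ.%ℕ N
    d = i ℤ./ℕ N
    i≡r+dN : i ≡ + r ℤ.+ d ℤ.* + N
    i≡r+dN = ℤ.a≡a%ℕn+[a/ℕn]*n i N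
    r<N : r ℕ.< N
    r<N = ℤ.n%ℕd<d i N
    trivial-r : Trivial (+ r)
    trivial-r x x≉0 = begin
      W (+ r) x                        ≈⟨ *-identityʳ _ ⟨
      W (+ r) x * 1#                   ≈⟨ *-congˡ (Trivial-multiple d x x≉0) ⟨
      W (+ r) x * W (d ℤ.* + N) x      ≈⟨ W-+ (+ r) _ x ⟨
      W (+ r ℤ.+ d ℤ.* + N) x          ≡⟨ ≡.cong (λ j → W j x) i≡r+dN ⟨
      W i x                            ≈⟨ trivial x x≉0 ⟩
      1#                               ∎
    r≡0 : r ≡ 0
    r≡0 = ≡.trans (≡.sym (Fin.toℕ-fromℕ< r<N)) (W-faithful (fromℕ< r<N)
      (≡.subst (λ m → Trivial (+ m)) (≡.sym (Fin.toℕ-fromℕ< r<N)) trivial-r))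

  ∑-nontrivial : ∀ i → ¬ Trivial i → ∑ᶠ (W i) ≈ 0#
  ∑-nontrivial i nontrivial =
    [ (λ S≈0 → S≈0)
    , (λ S≈N → contradiction (λ y y≉0 → stabilizer-trivial N S≈N (absorb y y≉0)) nontrivial)
    ]′ (quasi-idempotent N square)
    where
    S = ∑ᶠ (W i)
    absorb : ∀ y → ¬ y F.≈ F.0# → W i y * S ≈ S
    absorb y y≉0 = begin
      W i y * S                      ≈⟨ ∑ᶠ-*ˡ _ (W i) ⟩
      ∑ᶠ (λ x → W i y * W i x)       ≈⟨ ∑ᶠ-cong (λ x → W-* i y x) ⟨
      ∑ᶠ (λ x → W i (y F.* x))       ≈⟨ ∑ᶠ-scale (W-cong i) y≉0 ⟨
      S                              ∎
    -- At y = 0 absorption fails, since `W i` vanishes there. The weight `W (+ 0) y` repairs this,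
    -- and its sum over y supplies the factor N instead of q.
    absorb₀ : ∀ y → W i y * S ≈ W (+ 0) y * S
    absorb₀ y with y F.≟ F.0#
    ... | yes y≈0 = *-congʳ (trans (W-≈0 i y≈0) (sym (W-≈0 (+ 0) y≈0)))
    ... | no  y≉0 = trans (absorb y y≉0) (sym (trans (*-congʳ (W-0 y y≉0)) (*-identityˡ S)))
    square : S * S ≈ N · S
    square = begin
      S * S                          ≈⟨ ∑ᶠ-*ʳ S (W i) ⟩
      ∑ᶠ (λ y → W i y * S)           ≈⟨ ∑ᶠ-cong absorb₀ ⟩
      ∑ᶠ (λ y → W (+ 0) y * S)       ≈⟨ ∑ᶠ-*ʳ S (W (+ 0)) ⟨
      ∑ᶠ (W (+ 0)) * S               ≈⟨ *-congʳ ∑-trivial ⟩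
      (N · 1#) * S                   ≈⟨ ·-as-* N S ⟨
      N · S                          ∎

  -- The dual form of orthogonality: the point is fixed and the character varies. The value turns
  -- out to be N times the indicator of z = 1.
  dualSum : F.Carrier → Carrier
  dualSum z = sum {N} λ k → W (+ toℕ k) z

  dualSum-≈0 : ∀ {z} → z F.≈ F.0# → dualSum z ≈ 0#
  dualSum-≈0 z≈0 = sum-0 {N} λ k → W-≈0 (+ toℕ k) z≈0

  dualSum-≈1 : ∀ {z} → z F.≈ F.1# → dualSum z ≈ N · 1#
  dualSum-≈1 z≈1 = trans
    (sum-cong-≋ {N} λ k → trans (W-cong (+ toℕ k) z≈1) (W-at-1 (+ toℕ k)))
    (sum-replicate N)

  -- For z ≠ 0, multiplication by ω(z) shifts the powers of ω(z) cyclically because ω^N = 1, so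
  -- every summand absorbs into the sum.
  dualSum-dichotomy : ∀ z → dualSum z ≈ 0# ⊎ dualSum z ≈ N · 1#
  dualSum-dichotomy z with z F.≟ F.0#
  ... | yes z≈0 = inj₁ (dualSum-≈0 z≈0)
  ... | no  z≉0 = quasi-idempotent N square
    where
    D = dualSum z
    W-suc : ∀ m → W (+ suc m) z ≈ W (+ 1) z * W (+ m) z
    W-suc m = W-+ (+ 1) (+ m) z
    absorb-1 : W (+ 1) z * D ≈ D
    -- With ω^0(z) added on both sides, the exponents 1, ..., N can be compared with 0, ..., N - 1.
    absorb-1 = +-cancelˡ (W (+ 0) z) _ _ (begin
      W (+ 0) z + W (+ 1) z * D
        ≈⟨ +-congˡ (*-distribˡ-sum {N} (W (+ 1) z) _) ⟩
      W (+ 0) z + sum {N} (λ k → W (+ 1) z * W (+ toℕ k) z)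
        ≈⟨ +-congˡ (sum-cong-≋ {N} λ k → W-suc (toℕ k)) ⟨
      W (+ 0) z + sum {N} (λ k → W (+ suc (toℕ k)) z)
        ≈⟨ sum-shift (λ m → W (+ m) z) N ⟩
      D + W (+ N) z
        ≈⟨ +-congˡ (trans (W-period z z≉0) (sym (W-0 z z≉0))) ⟩
      D + W (+ 0) z
        ≈⟨ +-comm _ _ ⟩
      W (+ 0) z + D ∎)
    absorb : ∀ m → W (+ m) z * D ≈ D
    absorb zero    = trans (*-congʳ (W-0 z z≉0)) (*-identityˡ D)
    absorb (suc m) = begin
      W (+ suc m) z * D              ≈⟨ *-congʳ (W-suc m) ⟩
      W (+ 1) z * W (+ m) z * D      ≈⟨ *-assoc _ _ _ ⟩
      W (+ 1) z * (W (+ m) z * D)    ≈⟨ *-congˡ (absorb m) ⟩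
      W (+ 1) z * D                  ≈⟨ absorb-1 ⟩
      D                              ∎
    square : D * D ≈ N · D
    square = begin
      D * D                                ≈⟨ *-distribʳ-sum {N} D _ ⟩
      sum {N} (λ k → W (+ toℕ k) z * D)    ≈⟨ sum-cong-≋ {N} (λ k → absorb (toℕ k)) ⟩
      sum {N} (λ _ → D)                    ≈⟨ sum-replicate N ⟩
      N · D                                ∎

  ∑-dualSum : ∑ᶠ dualSum ≈ N · 1#
  ∑-dualSum = begin
    ∑ᶠ dualSum                              ≈⟨ ∑ᶠ-sum-swap {N} _ ⟩
    sum {N} (λ k → ∑ᶠ (W (+ toℕ k)))        ≈⟨ only-0 N W-faithful ⟩
    ∑ᶠ (W (+ 0))                            ≈⟨ ∑-trivial ⟩
    N · 1#                                  ∎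
    where
    -- N is generalised to a variable so that it can be matched as a successor, which provides the
    -- index `Fin.zero` of the surviving term.
    only-0 : ∀ n .{{_ : NonZero n}} → (∀ (k : Fin n) → Trivial (+ toℕ k) → toℕ k ≡ 0) →
             sum {n} (λ k → ∑ᶠ (W (+ toℕ k))) ≈ ∑ᶠ (W (+ 0))
    only-0 (suc n) faithful = sum-delta {suc n} _ Fin.zero λ k k≢0 →
      ∑-nontrivial (+ toℕ k) λ trivial → k≢0 (Fin.toℕ-injective (faithful k trivial))

  -- Each dualSum z is 0 or q - 1 and together they add up to q - 1, so only z = 1 contributes.
  dualSum-≉1 : ∀ {z} → ¬ z F.≈ F.1# → dualSum z ≈ 0#
  dualSum-≉1 {z} z≉1 with dualSum-dichotomy z
  ... | inj₁ D≈0 = D≈0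
  ... | inj₂ D≈N = contradiction (·1≈1⇒≡1 _ (·1-cancelʳ N (begin
      (total · 1#) * (N · 1#)    ≈⟨ ·-as-* total (N · 1#) ⟨
      total · (N · 1#)           ≈⟨ sum-· (e ∘ F.element) (N · 1#) ⟨
      sum (λ i → e (F.element i) · (N · 1#))
                                 ≡⟨ ∑ᶠ≡sum (λ x → e x · (N · 1#)) ⟨
      ∑ᶠ (λ x → e x · (N · 1#))  ≈⟨ ∑ᶠ-cong dualSum≈e ⟨
      ∑ᶠ dualSum                 ≈⟨ ∑-dualSum ⟩
      N · 1#                     ≈⟨ *-identityˡ _ ⟨
      1# * (N · 1#)              ∎)))
    (two-ones⇒sum≢1 (e ∘ F.element) {F.index z} {F.index F.1#}
      (λ eq → z≉1 (F.trans (F.sym (element-index z))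
        (F.trans (F.reflexive (≡.cong F.element eq)) (element-index F.1#))))
      (e≡1 (trans (dualSum-cong (element-index z)) D≈N))
      (e≡1 (dualSum-≈1 (element-index F.1#))))
    where
    e : F.Carrier → ℕ
    e x = [ const 0 , const 1 ]′ (dualSum-dichotomy x)
    total : ℕ
    total = CommutativeMonoidSum.sum ℕ.+-0-commutativeMonoid (e ∘ F.element)
    dualSum-cong : Congruent dualSum
    dualSum-cong x≈y = sum-cong-≋ {N} λ k → W-cong (+ toℕ k) x≈y
    dualSum≈e : ∀ x → dualSum x ≈ e x · (N · 1#)
    dualSum≈e x with dualSum-dichotomy x
    ... | inj₁ D≈0 = D≈0
    ... | inj₂ D≈N = trans D≈N (sym (×-homo-1 _))
    e≡1 : ∀ {x} → dualSum x ≈ N · 1# → e x ≡ 1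
    e≡1 {x} D≈N with dualSum-dichotomy x
    ... | inj₂ _   = ≡.refl
    ... | inj₁ D≈0 = contradiction (trans (sym (1/-* N)) (trans (*-congˡ (trans (sym D≈N) D≈0)) (zeroʳ _))) 1≉0

-- Orthogonality of additive characters

record IsAdditiveCharacter {k ℓk c ℓ q} (K : CommutativeRing k ℓk) (F : FiniteField c ℓ q)
    (T : FiniteField.Carrier F → CommutativeRing.Carrier K) : Set (ℓk ⊔ c ⊔ ℓ) where
  open CommutativeRing K
  private module F = FiniteField F
  field
    T-cong       : ∀ {x y} → x F.≈ y → T x ≈ T y
    T-+          : ∀ x y → T (x F.+ y) ≈ T x * T y
    T-0          : T F.0# ≈ 1#
    T-nontrivial : ¬ (∀ x → T x ≈ 1#)

module AdditiveCharacters {k ℓk c ℓ q} {K : CommutativeRing k ℓk}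
    (scalar : IsScalarRing K) {F : FiniteField c ℓ q}
    {T : FiniteField.Carrier F → CommutativeRing.Carrier K}
    (additive : IsAdditiveCharacter K F T) where
  open CommutativeRing K
  open ScalarRing scalar
  open SemiringSum semiring
  open SemiringMult semiring renaming (_×_ to _·_)
  open FieldSums scalar F
  open IsAdditiveCharacter additive
  open SetoidReasoning setoid

  ∑-T : ∑ᶠ T ≈ 0#
  ∑-T =
    [ (λ S≈0 → S≈0)
    , (λ S≈q → contradiction (λ y → stabilizer-trivial q S≈q (absorb y)) T-nontrivial)
    ]′ (quasi-idempotent q square)
    where
    absorb : ∀ y → T y * ∑ᶠ T ≈ ∑ᶠ T
    absorb y = begin
      T y * ∑ᶠ T                 ≈⟨ ∑ᶠ-*ˡ (T y) T ⟩
      ∑ᶠ (λ x → T y * T x)       ≈⟨ ∑ᶠ-cong (T-+ y) ⟨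
      ∑ᶠ (λ x → T (y F.+ x))     ≈⟨ ∑ᶠ-translate T-cong y ⟨
      ∑ᶠ T                       ∎
    square : ∑ᶠ T * ∑ᶠ T ≈ q · ∑ᶠ T
    square = begin
      ∑ᶠ T * ∑ᶠ T                ≈⟨ ∑ᶠ-*ʳ (∑ᶠ T) T ⟩
      ∑ᶠ (λ y → T y * ∑ᶠ T)      ≈⟨ ∑ᶠ-cong absorb ⟩
      ∑ᶠ (λ _ → ∑ᶠ T)            ≈⟨ ∑ᶠ-const _ ⟩
      q · ∑ᶠ T                   ∎

  ∑-T-≉0 : ∀ {a} → ¬ a F.≈ F.0# → ∑ᶠ (λ c → T (a F.* c)) ≈ 0#
  ∑-T-≉0 a≉0 = trans (sym (∑ᶠ-scale T-cong a≉0)) ∑-T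

  ∑-T-≈0 : ∀ {a} → a F.≈ F.0# → ∑ᶠ (λ c → T (a F.* c)) ≈ q · 1#
  ∑-T-≈0 a≈0 = trans
    (∑ᶠ-cong λ c → trans (T-cong (F.trans (F.*-congʳ a≈0) (F.zeroˡ c))) T-0)
    (∑ᶠ-const 1#)

-- Gauss sums: twisting, inverses and products

module GaussSums {k ℓk c ℓ q} {K : CommutativeRing k ℓk}
    (scalar : IsScalarRing K) {F : FiniteField c ℓ q}
    {W : ℤ → FiniteField.Carrier F → CommutativeRing.Carrier K}
    (family : IsCharacterFamily K F W)
    {T : FiniteField.Carrier F → CommutativeRing.Carrier K}
    (additive : IsAdditiveCharacter K F T) where
  open CommutativeRing K
  open ScalarRing scalar
  open SemiringMult semiring renaming (_×_ to _·_)
  open FieldSums scalar F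
  open IsCharacterFamily family
  open MultiplicativeCharacters scalar family
  open IsAdditiveCharacter additive
  open AdditiveCharacters scalar additive
  open CommutativeMonoidSolver *-commutativeMonoid using (solve; _⊜_) renaming (_⊕_ to _⊗_)
  open SetoidReasoning setoid

  gauss : ℤ → Carrier
  gauss i = ∑ᶠ λ x → W i x * T x

  -- For a ≠ 0 this is the substitution y ↦ y/a. At a = 0 the left side is Σ ω^i(y) = 0 by
  -- nontriviality, which agrees with the value 0 of `W` at 0; hence the formula holds for every a.
  gauss-twist : ∀ i → ¬ Trivial i → ∀ a →
                ∑ᶠ (λ y → W i y * T (y F.* a)) ≈ W (ℤ.- i) a * gauss i
  gauss-twist i nontrivial a with a F.≟ F.0#
  ... | yes a≈0 = begin
    ∑ᶠ (λ y → W i y * T (y F.* a))   ≈⟨ ∑ᶠ-cong (λ y → trans (*-congˡ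
                                          (trans (T-cong (F.trans (F.*-congˡ a≈0) (F.zeroʳ y))) T-0))
                                          (*-identityʳ (W i y))) ⟩
    ∑ᶠ (W i)                         ≈⟨ ∑-nontrivial i nontrivial ⟩
    0#                               ≈⟨ zeroˡ _ ⟨
    0# * gauss i                     ≈⟨ *-congʳ (W-≈0 (ℤ.- i) a≈0) ⟨
    W (ℤ.- i) a * gauss i            ∎
  ... | no a≉0 = begin
    S                                          ≈⟨ *-identityˡ S ⟨
    1# * S                                     ≈⟨ *-congʳ (W-inverse i a≉0) ⟨
    W (ℤ.- i) a * W i a * S                    ≈⟨ *-assoc _ _ _ ⟩
    W (ℤ.- i) a * (W i a * S)                  ≈⟨ *-congˡ (∑ᶠ-*ˡ _ _) ⟩
    W (ℤ.- i) a * ∑ᶠ (λ y → W i a * (W i y * T (y F.* a)))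
      ≈⟨ *-congˡ (∑ᶠ-cong λ y → trans (sym (*-assoc _ _ _))
           (*-cong (sym (W-* i a y)) (T-cong (F.*-comm y a)))) ⟩
    W (ℤ.- i) a * ∑ᶠ (λ y → W i (a F.* y) * T (a F.* y))
      ≈⟨ *-congˡ (∑ᶠ-scale (λ x≈y → *-cong (W-cong i x≈y) (T-cong x≈y)) a≉0) ⟨
    W (ℤ.- i) a * gauss i                      ∎
    where S = ∑ᶠ (λ y → W i y * T (y F.* a))

  -- At ℂ, where character values are roots of unity, this is the complex conjugate of `gauss i`
  -- divided by q.
  gaussInverse : ℤ → Carrier
  gaussInverse i = 1/ q * ∑ᶠ λ a → W (ℤ.- i) a * T (F.- a)

  -- The Fourier transform of c ↦ Σ_y ω^i(y) Θ(yc), evaluated at 1.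
  gaussInverse-* : ∀ i → ¬ Trivial i → gaussInverse i * gauss i ≈ 1#
  gaussInverse-* i nontrivial = begin
    1/ q * ∑ᶠ (λ a → W (ℤ.- i) a * T (F.- a)) * gauss i
      ≈⟨ *-assoc _ _ _ ⟩
    1/ q * (∑ᶠ (λ a → W (ℤ.- i) a * T (F.- a)) * gauss i)
      ≈⟨ *-congˡ (∑ᶠ-*ʳ (gauss i) _) ⟩
    1/ q * ∑ᶠ (λ a → W (ℤ.- i) a * T (F.- a) * gauss i)
      ≈⟨ *-congˡ (∑ᶠ-cong expand) ⟩
    1/ q * ∑ᶠ (λ a → ∑ᶠ (λ y → W i y * T ((y F.- F.1#) F.* a)))
      ≈⟨ *-congˡ (∑ᶠ-swap _) ⟩
    1/ q * ∑ᶠ (λ y → ∑ᶠ (λ a → W i y * T ((y F.- F.1#) F.* a)))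
      ≈⟨ *-congˡ (∑ᶠ-cong λ y → ∑ᶠ-*ˡ (W i y) _) ⟨
    1/ q * ∑ᶠ (λ y → W i y * ∑ᶠ (λ a → T ((y F.- F.1#) F.* a)))
      ≈⟨ *-congˡ (∑ᶠ-delta inner-cong F.1# inner-off) ⟩
    1/ q * (W i F.1# * ∑ᶠ (λ a → T ((F.1# F.- F.1#) F.* a)))
      ≈⟨ *-congˡ (*-cong (W-at-1 i) (∑-T-≈0 (F.-‿inverseʳ F.1#))) ⟩
    1/ q * (1# * (q · 1#))
      ≈⟨ *-congˡ (*-identityˡ _) ⟩
    1/ q * (q · 1#)
      ≈⟨ 1/-* q ⟩
    1# ∎
    where
    inner-cong : Congruent (λ y → W i y * ∑ᶠ (λ a → T ((y F.- F.1#) F.* a)))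
    inner-cong x≈y =
      *-cong (W-cong i x≈y) (∑ᶠ-cong λ a → T-cong (F.*-congʳ (F.+-congʳ x≈y)))
    inner-off : ∀ y → ¬ y F.≈ F.1# → W i y * ∑ᶠ (λ a → T ((y F.- F.1#) F.* a)) ≈ 0#
    inner-off y y≉1 =
      trans (*-congˡ (∑-T-≉0 λ eq → y≉1 (F.x∙y⁻¹≈ε⇒x≈y y F.1# eq))) (zeroʳ _)
    combine : ∀ y a → (y F.- F.1#) F.* a F.≈ y F.* a F.+ (F.- a)
    combine y a = F.trans (F.distribʳ a y (F.- F.1#)) (F.+-congˡ (F.-1*x≈-x a))
    expand : ∀ a → W (ℤ.- i) a * T (F.- a) * gauss i ≈
                   ∑ᶠ (λ y → W i y * T ((y F.- F.1#) F.* a))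
    expand a = begin
      W (ℤ.- i) a * T (F.- a) * gauss i
        ≈⟨ solve 3 (λ w t g → (w ⊗ t) ⊗ g ⊜ (w ⊗ g) ⊗ t) refl (W (ℤ.- i) a) (T (F.- a)) (gauss i) ⟩
      W (ℤ.- i) a * gauss i * T (F.- a)
        ≈⟨ *-congʳ (gauss-twist i nontrivial a) ⟨
      ∑ᶠ (λ y → W i y * T (y F.* a)) * T (F.- a)
        ≈⟨ ∑ᶠ-*ʳ (T (F.- a)) _ ⟩
      ∑ᶠ (λ y → W i y * T (y F.* a) * T (F.- a))
        ≈⟨ ∑ᶠ-cong (λ y → trans (*-assoc _ _ _)
             (*-congˡ (sym (trans (T-cong (combine y a)) (T-+ _ _))))) ⟩
      ∑ᶠ (λ y → W i y * T ((y F.- F.1#) F.* a)) ∎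

  -- Substitute x = -wy in the double sum over x and y.
  gauss-*-gauss : ∀ i j → ¬ Trivial (i ℤ.+ j) →
    gauss i * gauss j ≈
    gauss (i ℤ.+ j) * ∑ᶠ (λ w → W i (F.- w) * W (ℤ.- (i ℤ.+ j)) (F.1# F.- w))
  gauss-*-gauss i j nontrivial = begin
    gauss i * gauss j
      ≈⟨ ∑ᶠ-*ˡ (gauss i) _ ⟩
    ∑ᶠ (λ y → gauss i * (W j y * T y))
      ≈⟨ ∑ᶠ-cong substitute ⟩
    ∑ᶠ (λ y → ∑ᶠ (λ w → W i (F.- w) * (W γ y * T (y F.* (F.1# F.- w)))))
      ≈⟨ ∑ᶠ-swap _ ⟩
    ∑ᶠ (λ w → ∑ᶠ (λ y → W i (F.- w) * (W γ y * T (y F.* (F.1# F.- w)))))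
      ≈⟨ ∑ᶠ-cong (λ w → ∑ᶠ-*ˡ (W i (F.- w)) _) ⟨
    ∑ᶠ (λ w → W i (F.- w) * ∑ᶠ (λ y → W γ y * T (y F.* (F.1# F.- w))))
      ≈⟨ ∑ᶠ-cong (λ w → *-congˡ (gauss-twist γ nontrivial (F.1# F.- w))) ⟩
    ∑ᶠ (λ w → W i (F.- w) * (W (ℤ.- γ) (F.1# F.- w) * gauss γ))
      ≈⟨ ∑ᶠ-cong (λ w → solve 3 (λ a b g → a ⊗ (b ⊗ g) ⊜ g ⊗ (a ⊗ b)) refl
           (W i (F.- w)) (W (ℤ.- γ) (F.1# F.- w)) (gauss γ)) ⟩
    ∑ᶠ (λ w → gauss γ * (W i (F.- w) * W (ℤ.- γ) (F.1# F.- w)))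
      ≈⟨ ∑ᶠ-*ˡ (gauss γ) _ ⟨
    gauss γ * ∑ᶠ (λ w → W i (F.- w) * W (ℤ.- γ) (F.1# F.- w)) ∎
    where
    γ = i ℤ.+ j
    substitute : ∀ y → gauss i * (W j y * T y) ≈
                       ∑ᶠ (λ w → W i (F.- w) * (W γ y * T (y F.* (F.1# F.- w))))
    substitute y with y F.≟ F.0#
    ... | yes y≈0 = trans
      (trans (*-congˡ (trans (*-congʳ (W-≈0 j y≈0)) (zeroˡ _))) (zeroʳ _))
      (sym (∑ᶠ-0 λ _ → trans (*-congˡ (trans (*-congʳ (W-≈0 γ y≈0)) (zeroˡ _))) (zeroʳ _)))
    ... | no y≉0 = begin
      gauss i * (W j y * T y)
        ≈⟨ *-congʳ (trans (∑ᶠ-scale f-cong y≉0)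
             (∑ᶠ-negate λ x≈y → f-cong (F.*-congˡ x≈y))) ⟩
      ∑ᶠ (λ w → W i (y F.* (F.- w)) * T (y F.* (F.- w))) * (W j y * T y)
        ≈⟨ ∑ᶠ-*ʳ _ _ ⟩
      ∑ᶠ (λ w → W i (y F.* (F.- w)) * T (y F.* (F.- w)) * (W j y * T y))
        ≈⟨ ∑ᶠ-cong term ⟩
      ∑ᶠ (λ w → W i (F.- w) * (W γ y * T (y F.* (F.1# F.- w)))) ∎
      where
      f-cong : Congruent (λ x → W i x * T x)
      f-cong x≈y = *-cong (W-cong i x≈y) (T-cong x≈y)
      combine : ∀ w → y F.* (F.1# F.- w) F.≈ y F.+ y F.* (F.- w)
      combine w = F.trans (F.distribˡ y F.1# (F.- w)) (F.+-congʳ (F.*-identityʳ y))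
      term : ∀ w → W i (y F.* (F.- w)) * T (y F.* (F.- w)) * (W j y * T y) ≈
                   W i (F.- w) * (W γ y * T (y F.* (F.1# F.- w)))
      term w = begin
        W i (y F.* (F.- w)) * T (y F.* (F.- w)) * (W j y * T y)
          ≈⟨ *-congʳ (*-congʳ (W-* i y (F.- w))) ⟩
        W i y * W i (F.- w) * T (y F.* (F.- w)) * (W j y * T y)
          ≈⟨ solve 5 (λ a b t c u → ((a ⊗ b) ⊗ t) ⊗ (c ⊗ u) ⊜ b ⊗ ((a ⊗ c) ⊗ (u ⊗ t))) refl
               (W i y) (W i (F.- w)) (T (y F.* (F.- w))) (W j y) (T y) ⟩
        W i (F.- w) * (W i y * W j y * (T y * T (y F.* (F.- w))))
          ≈⟨ *-congˡ (*-cong (W-+ i j y) (trans (T-cong (combine w)) (T-+ _ _))) ⟨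
        W i (F.- w) * (W γ y * T (y F.* (F.1# F.- w))) ∎

-- Hypergeometric sums as sums over the hypersurface

module HypergeometricSums {k ℓk c ℓ q} {K : CommutativeRing k ℓk}
    (scalar : IsScalarRing K) {F : FiniteField c ℓ q}
    {ω^ : Frac (q ∸ 1) → FiniteField.Carrier F → CommutativeRing.Carrier K}
    (family : IsCharacterFamily K F (λ i → ω^ (i /N)))
    {T : FiniteField.Carrier F → CommutativeRing.Carrier K}
    (additive : IsAdditiveCharacter K F T) where
  open CommutativeRing K
  open IsScalarRing scalar using (-1/; -1/-*)
  open ScalarRing scalar
  open SemiringMult semiring using () renaming (_×_ to _·_)
  open SemiringSum semiring
  open RingProperties ring
  open FieldSums scalar F
  open IsCharacterFamily family
  open MultiplicativeCharacters scalar family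
  open IsAdditiveCharacter additive
  open GaussSums scalar family additive
  open Characters F using (OnHypersurface; onHypersurface?; offZeroOne?; nonzero?; prodᶠ; powᶠ)
  open CommutativeMonoidSum *-commutativeMonoid using ()
    renaming (sum to prod; sum-cong-≋ to prod-cong; sum-remove to prod-remove; ∑-distrib-+ to prod-*)
  open CommutativeMonoidSolver *-commutativeMonoid using (solve; _⊜_) renaming (_⊕_ to _⊗_)
  open SetoidReasoning setoid

  private
    W : ℤ → F.Carrier → Carrier
    W i = ω^ (i /N)

  prod-0 : ∀ {n} {h : Fin n → Carrier} i → h i ≈ 0# → prod h ≈ 0#
  prod-0 {suc n} {h} i hᵢ≈0 =
    trans (prod-remove {i = i} h) (trans (*-congʳ hᵢ≈0) (zeroˡ _))

  ∑ᵗ : ∀ n → ((Fin n → F.Carrier) → Carrier) → Carrier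
  ∑ᵗ zero    f = f []
  ∑ᵗ (suc n) f = ∑ᶠ λ y → ∑ᵗ n λ x → f (y ∷ x)

  ∑ᵗ-cong : ∀ n {f h} → (∀ x → f x ≈ h x) → ∑ᵗ n f ≈ ∑ᵗ n h
  ∑ᵗ-cong zero    f≈h = f≈h []
  ∑ᵗ-cong (suc n) f≈h = ∑ᶠ-cong λ y → ∑ᵗ-cong n λ x → f≈h (y ∷ x)

  ∑ᵗ-*ˡ : ∀ n a f → a * ∑ᵗ n f ≈ ∑ᵗ n (λ x → a * f x)
  ∑ᵗ-*ˡ zero    a f = refl
  ∑ᵗ-*ˡ (suc n) a f = trans (∑ᶠ-*ˡ a _) (∑ᶠ-cong λ y → ∑ᵗ-*ˡ n a λ x → f (y ∷ x))

  ∑ᵗ-sum-swap : ∀ n {m} (f : (Fin n → F.Carrier) → Fin m → Carrier) →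
                sum (λ k → ∑ᵗ n (λ x → f x k)) ≈ ∑ᵗ n (λ x → sum (f x))
  ∑ᵗ-sum-swap zero    f = refl
  ∑ᵗ-sum-swap (suc n) f = trans (sym (∑ᶠ-sum-swap λ y k → ∑ᵗ n (λ x → f (y ∷ x) k)))
    (∑ᶠ-cong λ y → ∑ᵗ-sum-swap n λ x → f (y ∷ x))

  prod-∑ᶠ : ∀ n (h : Fin n → F.Carrier → Carrier) →
            prod (λ i → ∑ᶠ (h i)) ≈ ∑ᵗ n (λ x → prod (λ i → h i (x i)))
  prod-∑ᶠ zero    h = refl
  prod-∑ᶠ (suc n) h = begin
    ∑ᶠ (h Fin.zero) * prod (λ i → ∑ᶠ (h (Fin.suc i)))
      ≈⟨ *-congˡ (prod-∑ᶠ n (h ∘ Fin.suc)) ⟩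
    ∑ᶠ (h Fin.zero) * ∑ᵗ n (λ x → prod (λ i → h (Fin.suc i) (x i)))
      ≈⟨ ∑ᶠ-*ʳ _ (h Fin.zero) ⟩
    ∑ᶠ (λ y → h Fin.zero y * ∑ᵗ n (λ x → prod (λ i → h (Fin.suc i) (x i))))
      ≈⟨ ∑ᶠ-cong (λ y → ∑ᵗ-*ˡ n (h Fin.zero y) _) ⟩
    ∑ᵗ (suc n) (λ x → prod (λ i → h i (x i))) ∎

  W-prodᶠ : ∀ i {n} (x : Fin n → F.Carrier) → W i (prodᶠ x) ≈ prod (λ j → W i (x j))
  W-prodᶠ i {zero}  x = W-at-1 i
  W-prodᶠ i {suc n} x = trans (W-* i _ _) (*-congˡ (W-prodᶠ i (x ∘ Fin.suc)))

  -- This is what the factor (-1)^n in the argument of `H` achieves: it cancels the n signs coming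
  -- from the factors ω^μ(-xᵢ).
  signs : ∀ n (x : Fin n → F.Carrier) →
          powᶠ (F.- F.1#) n F.* prodᶠ (λ i → F.- x i) F.≈ prodᶠ x
  signs zero    x = F.*-identityˡ F.1#
  signs (suc n) x = F.trans
    (interchange (F.- F.1#) (powᶠ (F.- F.1#) n) (F.- x Fin.zero) (prodᶠ (λ i → F.- x (Fin.suc i))))
    (F.*-cong (F.trans (F.-1*x≈-x _) (F.-‿involutive _)) (signs n (x ∘ Fin.suc)))
    where open CommutativeSemigroupProperties F.*-commutativeSemigroup using (interchange)

  -- `S` stands for `sumTuples` at ℂ, where both recursion equations hold by reflexivity; they
  -- determine it.
  ∑ᵗ-unique : (S : ∀ n → ((Fin n → F.Carrier) → Carrier) → Carrier) →
    (∀ f → S 0 f ≡ f []) →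
    (∀ n f → S (suc n) f ≡ sum λ j → S n λ x → f (F.element j ∷ x)) →
    ∀ n {f h} → (∀ x → f x ≈ h x) → S n f ≈ ∑ᵗ n h
  ∑ᵗ-unique S S-zero S-suc zero    {f} f≈h = trans (reflexive (S-zero f)) (f≈h [])
  ∑ᵗ-unique S S-zero S-suc (suc n) {f} {h} f≈h = begin
    S (suc n) f
      ≡⟨ S-suc n f ⟩
    sum (λ j → S n λ x → f (F.element j ∷ x))
      ≈⟨ sum-cong-≋ {q} (λ j → ∑ᵗ-unique S S-zero S-suc n λ x → f≈h (F.element j ∷ x)) ⟩
    sum (λ j → ∑ᵗ n λ x → h (F.element j ∷ x))
      ≡⟨ ∑ᶠ≡sum (λ y → ∑ᵗ n λ x → h (y ∷ x)) ⟨
    ∑ᵗ (suc n) h ∎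

  gaussSum : Frac N → Carrier
  gaussSum μ = sum λ j →
    if does (nonzero? (F.element j)) then ω^ μ (F.element j) * T (F.element j) else 0#

  -- Extension of the characters by zero makes the restriction to nonzero points redundant.
  gaussSum≈gauss : ∀ μ → gaussSum μ ≈ gauss (num μ)
  gaussSum≈gauss μ = trans (sum-cong-≋ {q} (λ j → restrict (F.element j))) (reflexive (≡.sym (∑ᶠ≡sum _)))
    where
    restrict : ∀ x → (if does (nonzero? x) then ω^ μ x * T x else 0#) ≈ ω^ μ x * T x
    restrict x = if-dec (nonzero? x) (λ _ → refl) λ ¬x≉0 →
      sym (trans (*-congʳ (W-≈0 (num μ) (decidable-stable (x F.≟ F.0#) ¬x≉0))) (zeroˡ _))

  kernel : ℤ → ℤ → F.Carrier → Carrier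
  kernel a b x = W a (F.- x) * W (b ℤ.+ ℤ.- a) (F.1# F.- x)

  kernel-≈0 : ∀ a b {x} → x F.≈ F.0# → kernel a b x ≈ 0#
  kernel-≈0 a b x≈0 =
    trans (*-congʳ (W-≈0 a (F.trans (F.-‿cong x≈0) F.-0#≈0#))) (zeroˡ _)

  kernel-≈1 : ∀ a b {x} → x F.≈ F.1# → kernel a b x ≈ 0#
  kernel-≈1 a b x≈1 =
    trans (*-congˡ (W-≈0 (b ℤ.+ ℤ.- a) (F.x≈y⇒x∙y⁻¹≈ε (F.sym x≈1)))) (zeroʳ _)

  -- The exponents a + m and -b - m add up to a - b whatever m is. So the Gauss sum that factors out
  -- is always the denominator, and the same nontriviality assumption serves every m.
  quotient≈∑ᶠ : ∀ a b m {v} → ¬ Trivial (a ℤ.+ ℤ.- b) → v * gauss (a ℤ.+ ℤ.- b) ≈ 1# →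
    gauss (a ℤ.+ m) * gauss (ℤ.- b ℤ.+ ℤ.- m) * v ≈ ∑ᶠ (λ x → W m (F.- x) * kernel a b x)
  quotient≈∑ᶠ a b m {v} nontrivial inverse = begin
    gauss (a ℤ.+ m) * gauss (ℤ.- b ℤ.+ ℤ.- m) * v
      ≈⟨ *-congʳ (gauss-*-gauss (a ℤ.+ m) (ℤ.- b ℤ.+ ℤ.- m)
           (≡.subst (λ i → ¬ Trivial i) (≡.sym (sum-≡ a b m)) nontrivial)) ⟩
    gauss γ * ∑ᶠ (λ x → W (a ℤ.+ m) (F.- x) * W (ℤ.- γ) (F.1# F.- x)) * v
      ≈⟨ *-congʳ (*-cong (reflexive (≡.cong gauss (sum-≡ a b m))) (∑ᶠ-cong term)) ⟩
    gauss (a ℤ.+ ℤ.- b) * S * v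
      ≈⟨ solve 3 (λ g s v → (g ⊗ s) ⊗ v ⊜ (v ⊗ g) ⊗ s) refl (gauss (a ℤ.+ ℤ.- b)) S v ⟩
    v * gauss (a ℤ.+ ℤ.- b) * S
      ≈⟨ *-congʳ inverse ⟩
    1# * S
      ≈⟨ *-identityˡ S ⟩
    S ∎
    where
    γ = (a ℤ.+ m) ℤ.+ (ℤ.- b ℤ.+ ℤ.- m)
    S = ∑ᶠ (λ x → W m (F.- x) * kernel a b x)
    sum-≡ : ∀ a b m → (a ℤ.+ m) ℤ.+ (ℤ.- b ℤ.+ ℤ.- m) ≡ a ℤ.+ ℤ.- b
    sum-≡ = solve-∀
    neg-≡ : ∀ a b m → ℤ.- ((a ℤ.+ m) ℤ.+ (ℤ.- b ℤ.+ ℤ.- m)) ≡ b ℤ.+ ℤ.- a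
    neg-≡ = solve-∀
    term : ∀ x → W (a ℤ.+ m) (F.- x) * W (ℤ.- γ) (F.1# F.- x) ≈ W m (F.- x) * kernel a b x
    term x = begin
      W (a ℤ.+ m) (F.- x) * W (ℤ.- γ) (F.1# F.- x)
        ≈⟨ *-cong (W-+ a m (F.- x)) (reflexive (≡.cong (λ i → W i (F.1# F.- x)) (neg-≡ a b m))) ⟩
      W a (F.- x) * W m (F.- x) * W (b ℤ.+ ℤ.- a) (F.1# F.- x)
        ≈⟨ solve 3 (λ u w z → (u ⊗ w) ⊗ z ⊜ w ⊗ (u ⊗ z)) refl _ _ _ ⟩
      W m (F.- x) * kernel a b x ∎

  module _ {n} (a b : Fin n → ℤ) (nontrivial : ∀ i → ¬ Trivial (a i ℤ.+ ℤ.- b i))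
           (v : Fin n → Carrier) (inverse : ∀ i → v i * gauss (a i ℤ.+ ℤ.- b i) ≈ 1#)
           (t : F.Carrier) where

    integrand : (Fin n → F.Carrier) → Carrier
    integrand x = prod λ i → kernel (a i) (b i) (x i)

    restricted : (Fin n → F.Carrier) → Carrier
    restricted x = if does (onHypersurface? t x) then integrand x else 0#

    dualSum-integrand : ∀ x →
      integrand x * dualSum (t F.* prodᶠ x) ≈ (N · 1#) * restricted x
    dualSum-integrand x = by-cases (onHypersurface? t x) (t F.* prodᶠ x F.≟ F.1#)
      where
      -- The decision is an argument so that matching on it reduces the `if` hidden in `restricted`.
      by-cases : (hyp? : Dec (OnHypersurface t x)) → Dec (t F.* prodᶠ x F.≈ F.1#) →
                 integrand x * dualSum (t F.* prodᶠ x) ≈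
                 (N · 1#) * (if does hyp? then integrand x else 0#)
      by-cases (yes (_ , tx≈1)) _        = trans (*-congˡ (dualSum-≈1 tx≈1)) (*-comm _ _)
      by-cases (no _)  (no tx≉1)         =
        trans (*-congˡ (dualSum-≉1 tx≉1)) (trans (zeroʳ _) (sym (zeroʳ _)))
      by-cases (no ¬h) (yes tx≈1)        =
        trans (*-congʳ (prod-0 i vanishes)) (trans (zeroˡ _) (sym (zeroʳ _)))
        where
        -- The product condition holds, so some coordinate must be 0 or 1; finitely many decidable
        -- conditions allow one to be exhibited.
        bad = Fin.¬∀⟶∃¬ n _ (λ i → offZeroOne? (x i)) λ off → ¬h (off , tx≈1)
        i = proj₁ bad
        vanishes : kernel (a i) (b i) (x i) ≈ 0#
        vanishes =
          [ kernel-≈0 (a i) (b i)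
          , (λ x≉0 → kernel-≈1 (a i) (b i)
              (decidable-stable (x i F.≟ F.1#) λ x≉1 → proj₂ bad (x≉0 , x≉1)))
          ]′ (toSum (x i F.≟ F.0#))

    hypergeometricTerm : ℤ → Carrier
    hypergeometricTerm m =
      prod (λ i → gauss (a i ℤ.+ m) * gauss (ℤ.- b i ℤ.+ ℤ.- m) * v i) * W m (powᶠ (F.- F.1#) n F.* t)

    hypergeometricSum : Carrier
    hypergeometricSum = -1/ N * sum {N} λ k → hypergeometricTerm (+ toℕ k)

    ∑-hypersurface : ∑ᵗ n restricted ≈ - hypergeometricSum
    ∑-hypersurface = sym (begin
      - hypergeometricSum
        ≈⟨ -‿cong (*-congˡ (sum-cong-≋ {N} λ k → summand (+ toℕ k))) ⟩
      - (-1/ N * sum {N} (λ k → ∑ᵗ n (λ x → integrand x * W (+ toℕ k) (t F.* prodᶠ x))))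
        ≈⟨ -‿cong (*-congˡ (∑ᵗ-sum-swap n {N} _)) ⟩
      - (-1/ N * ∑ᵗ n (λ x → sum {N} (λ k → integrand x * W (+ toℕ k) (t F.* prodᶠ x))))
        ≈⟨ -‿cong (*-congˡ (∑ᵗ-cong n λ x → *-distribˡ-sum {N} (integrand x) _)) ⟨
      - (-1/ N * ∑ᵗ n (λ x → integrand x * dualSum (t F.* prodᶠ x)))
        ≈⟨ -‿cong (*-congˡ (∑ᵗ-cong n dualSum-integrand)) ⟩
      - (-1/ N * ∑ᵗ n (λ x → (N · 1#) * restricted x))
        ≈⟨ -‿cong (*-congˡ (∑ᵗ-*ˡ n (N · 1#) restricted)) ⟨
      - (-1/ N * ((N · 1#) * ∑ᵗ n restricted))
        ≈⟨ -‿cong (*-assoc _ _ _) ⟨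
      - (-1/ N * (N · 1#) * ∑ᵗ n restricted)
        -- The prefactor -1/(q-1) meets the q - 1 from the dual sum and leaves only a sign.
        ≈⟨ -‿cong (trans (*-congʳ (-1/-* N)) (-1*x≈-x _)) ⟩
      - - ∑ᵗ n restricted
        ≈⟨ -‿involutive _ ⟩
      ∑ᵗ n restricted ∎)
      where
      s = powᶠ (F.- F.1#) n F.* t
      argument : ∀ x → s F.* prodᶠ (λ i → F.- x i) F.≈ t F.* prodᶠ x
      argument x = F.trans
        (F.trans (F.*-congʳ (F.*-comm _ t)) (F.*-assoc t _ _))
        (F.*-congˡ (signs n x))
      summand : ∀ m →
        hypergeometricTerm m ≈ ∑ᵗ n (λ x → integrand x * W m (t F.* prodᶠ x))
      summand m = begin
        hypergeometricTerm m
          ≈⟨ *-comm _ _ ⟩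
        W m s * prod (λ i → gauss (a i ℤ.+ m) * gauss (ℤ.- b i ℤ.+ ℤ.- m) * v i)
          ≈⟨ *-congˡ (prod-cong {n} λ i → quotient≈∑ᶠ (a i) (b i) m (nontrivial i) (inverse i)) ⟩
        W m s * prod (λ i → ∑ᶠ (λ x → W m (F.- x) * kernel (a i) (b i) x))
          ≈⟨ *-congˡ (prod-∑ᶠ n _) ⟩
        W m s * ∑ᵗ n (λ x → prod (λ i → W m (F.- x i) * kernel (a i) (b i) (x i)))
          ≈⟨ ∑ᵗ-*ˡ n (W m s) _ ⟩
        ∑ᵗ n (λ x → W m s * prod (λ i → W m (F.- x i) * kernel (a i) (b i) (x i)))
          ≈⟨ ∑ᵗ-cong n collect ⟩
        ∑ᵗ n (λ x → integrand x * W m (t F.* prodᶠ x)) ∎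
        where
        collect : ∀ x → W m s * prod (λ i → W m (F.- x i) * kernel (a i) (b i) (x i)) ≈
                        integrand x * W m (t F.* prodᶠ x)
        collect x = begin
          W m s * prod (λ i → W m (F.- x i) * kernel (a i) (b i) (x i))
            ≈⟨ *-congˡ (prod-* (λ i → W m (F.- x i)) _) ⟩
          W m s * (prod (λ i → W m (F.- x i)) * integrand x)
            ≈⟨ *-assoc _ _ _ ⟨
          W m s * prod (λ i → W m (F.- x i)) * integrand x
            ≈⟨ *-congʳ (*-congˡ (W-prodᶠ m (λ i → F.- x i))) ⟨
          W m s * W m (prodᶠ (λ i → F.- x i)) * integrand x
            ≈⟨ *-congʳ (trans (W-cong m (F.sym (argument x))) (W-* m s _)) ⟨
          W m (t F.* prodᶠ x) * integrand x
            ≈⟨ *-comm _ _ ⟩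
          integrand x * W m (t F.* prodᶠ x) ∎

  -- Comparing two products in ℂ that are not syntactically equal unfolds their Cauchy proofs and
  -- does not finish.  With the operations, g and the summands as variables, the instance at ℂ
  -- agrees syntactically with sums and products nested inside g and H.
  module _ (_*′_ : Carrier → Carrier → Carrier) (sum′ prod′ : ∀ n → (Fin n → Carrier) → Carrier)
           (0′ : Carrier) (sumOver′ : (F.Carrier → Carrier) → Carrier)
           (g : Frac (q ∸ 1) → Carrier) where

    gauss-isUnit : _*′_ ≡ _*_ → sum′ ≡ (λ n → sum {n}) → 0′ ≡ 0# →
      (∀ f → sumOver′ f ≡ sum′ q λ j → if does (nonzero? (F.element j)) then f (F.element j) else 0′) →
      (∀ μ → g μ ≡ sumOver′ λ x → ω^ μ x *′ T x) →
      ∀ μ → ¬ Trivial (num μ) → IsUnit K (g μ)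
    gauss-isUnit ≡.refl ≡.refl ≡.refl sumOver≡ g≡ μ nontrivial =
      gaussInverse (num μ) , inverse , trans (*-comm _ _) inverse
      where
      inverse : gaussInverse (num μ) * g μ ≈ 1#
      inverse = trans (*-congˡ (trans (reflexive (≡.trans (g≡ μ) (sumOver≡ _))) (gaussSum≈gauss μ)))
        (gaussInverse-* (num μ) nontrivial)

    -- The integrand `φ`, the value `h` and the argument `s` are tied to their intended forms by `≈`
    -- alone, so reflexivity serves for them at ℂ.
    hypersurface-formula : _*′_ ≡ _*_ → sum′ ≡ (λ n → sum {n}) → prod′ ≡ (λ n → prod {n}) → 0′ ≡ 0# →
      (∀ f → sumOver′ f ≡ sum′ q λ j → if does (nonzero? (F.element j)) then f (F.element j) else 0′) →
      (∀ μ → g μ ≡ sumOver′ λ x → ω^ μ x *′ T x) →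
      (S : ∀ n → ((Fin n → F.Carrier) → Carrier) → Carrier) →
      (∀ f → S 0 f ≡ f []) →
      (∀ n f → S (suc n) f ≡ sum′ q λ j → S n λ x → f (F.element j ∷ x)) →
      ∀ {n} (α β : Fin n → Frac (q ∸ 1)) → (∀ i → ¬ Trivial (num (α i ⊖ β i))) →
      (u : ∀ i → IsUnit K (g (α i ⊖ β i))) → ∀ t →
      (φ : (Fin n → F.Carrier) → Fin n → Carrier) →
      (∀ x i → φ x i ≈ ω^ (α i) (F.- x i) *′ ω^ (β i ⊖ α i) (F.1# F.- x i)) →
      (h : Carrier) (s : F.Carrier) →
      (h ≈ -1/ (q ∸ 1) *′ sum′ (q ∸ 1) λ k → let μ = (+ toℕ k) /N in
        prod′ n (λ i → (g (α i ⊕ μ) *′ g (⊝ β i ⊖ μ)) *′ proj₁ (u i)) *′ ω^ μ s) →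
      s F.≈ powᶠ (F.- F.1#) n F.* t →
      S n (λ x → if does (Characters.onHypersurface? F t x) then prod′ n (φ x) else 0′) ≈ - h
    hypersurface-formula ≡.refl ≡.refl ≡.refl ≡.refl sumOver≡ g≡ S S-zero S-suc {n} α β nontrivial u t
        φ φ≈ h s h≈ s≈ = begin
      S n (λ x → if does (onHypersurface? t x) then prod (φ x) else 0#)
        ≈⟨ ∑ᵗ-unique S S-zero S-suc n (λ x → if-cong (onHypersurface? t x) (prod-cong {n} (φ≈ x))) ⟩
      ∑ᵗ n (restricted a b nontrivial v inverse t)
        ≈⟨ ∑-hypersurface a b nontrivial v inverse t ⟩
      - hypergeometricSum a b nontrivial v inverse t
        ≈⟨ -‿cong (*-congˡ (sum-cong-≋ {N} λ k → *-cong (prod-cong {n} λ i →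
             *-congʳ (*-cong (g≈gauss (α i ⊕ ((+ toℕ k) /N))) (g≈gauss (⊝ β i ⊖ ((+ toℕ k) /N)))))
             (W-cong (+ toℕ k) s≈))) ⟨
      - (-1/ N * sum {N} λ k → let μ = (+ toℕ k) /N in
        prod {n} (λ i → (g (α i ⊕ μ) * g (⊝ β i ⊖ μ)) * v i) * ω^ μ s)
        ≈⟨ -‿cong h≈ ⟨
      - h ∎
      where
      if-cong : ∀ {p} {P : Set p} (P? : Dec P) {x y} → x ≈ y →
                (if does P? then x else 0#) ≈ (if does P? then y else 0#)
      if-cong (yes _) x≈y = x≈y
      if-cong (no _)  _   = refl
      g≈gauss : ∀ μ → g μ ≈ gauss (num μ)
      g≈gauss μ = trans (reflexive (≡.trans (g≡ μ) (sumOver≡ _))) (gaussSum≈gauss μ)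
      a b : Fin n → ℤ
      a i = num (α i)
      b i = num (β i)
      v : Fin n → Carrier
      v i = proj₁ (u i)
      inverse : ∀ i → v i * gauss (a i ℤ.+ ℤ.- b i) ≈ 1#
      inverse i = trans (*-congˡ (sym (g≈gauss (α i ⊖ β i)))) (proj₁ (proj₂ (u i)))

-- Arithmetic of fractions in ℚ

-- `_/_` reduces to lowest terms; for unnormalised fractions the identity is a cross multiplication.
/-+ : ∀ i j d .{{_ : NonZero d}} → (i / d) ℚ.+ (j / d) ≡ (i ℤ.+ j) / d
/-+ i j (suc d) = ℚ.toℚᵘ-injective (ℚᵘ.≃-trans (ℚ.toℚᵘ-homo-+ (i / suc d) (j / suc d))
  (ℚᵘ.≃-trans (ℚᵘ.+-cong (ℚ.toℚᵘ-fromℚᵘ (mkℚᵘ i d)) (ℚ.toℚᵘ-fromℚᵘ (mkℚᵘ j d)))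
    (ℚᵘ.≃-trans (*≡* (cross i j (+ suc d))) (ℚᵘ.≃-sym (ℚ.toℚᵘ-fromℚᵘ (mkℚᵘ (i ℤ.+ j) d))))))
  where
  cross : ∀ i j D → (i ℤ.* D ℤ.+ j ℤ.* D) ℤ.* D ≡ (i ℤ.+ j) ℤ.* (D ℤ.* D)
  cross = solve-∀

/-neg : ∀ i d .{{_ : NonZero d}} → ℚ.- (i / d) ≡ (ℤ.- i) / d
/-neg i (suc d) = ℚ.toℚᵘ-injective (ℚᵘ.≃-trans (ℚ.toℚᵘ-homo‿- (i / suc d))
  (ℚᵘ.≃-trans (ℚᵘ.-‿cong (ℚ.toℚᵘ-fromℚᵘ (mkℚᵘ i d))) (ℚᵘ.≃-sym (ℚ.toℚᵘ-fromℚᵘ (mkℚᵘ (ℤ.- i) d)))))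

/-cancel : ∀ i d .{{_ : NonZero d}} → (i ℤ.* + d) / d ≡ i / 1
/-cancel i (suc d) = ℚ.fromℚᵘ-cong {mkℚᵘ (i ℤ.* + suc d) d} {mkℚᵘ i 0} (*≡* (cross i (+ suc d)))
  where
  cross : ∀ i D → (i ℤ.* D) ℤ.* + 1 ≡ i ℤ.* D
  cross = solve-∀

-1/-*-/1 : ∀ d .{{_ : NonZero d}} → (-1ℤ / d) ℚ.* (+ d / 1) ≡ ℚ.- 1ℚ
-1/-*-/1 (suc d) = ℚ.toℚᵘ-injective (ℚᵘ.≃-trans (ℚ.toℚᵘ-homo-* (-1ℤ / suc d) (+ suc d / 1))
  (ℚᵘ.≃-trans (ℚᵘ.*-cong (ℚ.toℚᵘ-fromℚᵘ (mkℚᵘ -1ℤ d)) (ℚ.toℚᵘ-fromℚᵘ (mkℚᵘ (+ suc d) 0)))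
    (*≡* (cross (+ suc d)))))
  where
  cross : ∀ D → (-1ℤ ℤ.* D) ℤ.* + 1 ≡ -1ℤ ℤ.* (D ℤ.* + 1)
  cross = solve-∀

-- Idempotents of ℝ and ℂ

0ᴿ 1ᴿ : ℝ
0ᴿ = constᴿ 0ℚ
1ᴿ = constᴿ 1ℚ

¼ : ℚ
¼ = + 1 / 4

-- A uniform lower bound, which makes cancellation effective. The constant is what remains of a
-- distance ½ after an approximation error of ¼.
AwayFromZero : ℝ → Set
AwayFromZero v = ∃[ M ] ∀ n → M ℕ.≤ n → ¼ ℚ.≤ ℚ.∣ seq v n ∣

private
  sub-0 : ∀ p → p ℚ.- 0ℚ ≡ p
  sub-0 = ℚ.+-identityʳ

*ᴿ-cancel-away : ∀ u v → AwayFromZero v → u *ᴿ v ≈ᴿ 0ᴿ → u ≈ᴿ 0ᴿ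
*ᴿ-cancel-away u v (M , away) uv≈0 ε ε>0 = M ℕ.⊔ L , small
  where
  instance _ = ℚ.positive ε>0
  near = uv≈0 (ε ℚ.* ¼) (ℚ.positive⁻¹ _ {{ℚ.pos*pos⇒pos ε ¼}})
  L = proj₁ near
  small : ∀ n → M ℕ.⊔ L ℕ.≤ n → ℚ.∣ seq u n ℚ.- 0ℚ ∣ ℚ.< ε
  small n le = ≡.subst (λ p → ℚ.∣ p ∣ ℚ.< ε) (≡.sym (sub-0 uₙ))
    (ℚ.*-cancelʳ-<-nonNeg ¼ (begin-strict
      ℚ.∣ uₙ ∣ ℚ.* ¼         ≤⟨ ℚ.*-monoˡ-≤-nonNeg ℚ.∣ uₙ ∣ {{ℚ.∣-∣-nonNeg uₙ}}
                                  (away n (ℕ.≤-trans (ℕ.m≤m⊔n M L) le)) ⟩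
      ℚ.∣ uₙ ∣ ℚ.* ℚ.∣ vₙ ∣  ≡⟨ ℚ.∣p*q∣≡∣p∣*∣q∣ uₙ vₙ ⟨
      ℚ.∣ uₙ ℚ.* vₙ ∣        ≡⟨ ≡.cong ℚ.∣_∣ (sub-0 (uₙ ℚ.* vₙ)) ⟨
      ℚ.∣ uₙ ℚ.* vₙ ℚ.- 0ℚ ∣ <⟨ proj₂ near n (ℕ.≤-trans (ℕ.m≤n⊔m M L) le) ⟩
      ε ℚ.* ¼                ∎))
    where
    open ℚ.≤-Reasoning
    uₙ = seq u n
    vₙ = seq v n

-- The tolerance ε² suffices, because |u| ≥ ε at some index would give |u²| ≥ ε² there, and the
-- order of ℚ is decidable.
square≈0 : ∀ u → u *ᴿ u ≈ᴿ 0ᴿ → u ≈ᴿ 0ᴿ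
square≈0 u uu≈0 ε ε>0 with L , near ← uu≈0 (ε ℚ.* ε) (ℚ.positive⁻¹ _ {{ℚ.pos*pos⇒pos ε {{ℚ.positive ε>0}} ε {{ℚ.positive ε>0}}}}) =
  L , λ n L≤n → ≡.subst (λ p → ℚ.∣ p ∣ ℚ.< ε) (≡.sym (sub-0 (seq u n)))
    (ℚ.≰⇒> λ ε≤∣u∣ → ℚ.<-irrefl ≡.refl (ℚ.<-≤-trans (near n L≤n) (begin
      ε ℚ.* ε                                   ≤⟨ ℚ.*-monoˡ-≤-nonNeg ε {{ℚ.nonNegative (ℚ.<⇒≤ ε>0)}} ε≤∣u∣ ⟩
      ε ℚ.* ℚ.∣ seq u n ∣                       ≤⟨ ℚ.*-monoʳ-≤-nonNeg ℚ.∣ seq u n ∣ {{ℚ.∣-∣-nonNeg (seq u n)}} ε≤∣u∣ ⟩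
      ℚ.∣ seq u n ∣ ℚ.* ℚ.∣ seq u n ∣           ≡⟨ ℚ.∣p*q∣≡∣p∣*∣q∣ (seq u n) (seq u n) ⟨
      ℚ.∣ seq u n ℚ.* seq u n ∣                 ≡⟨ ≡.cong ℚ.∣_∣ (sub-0 (seq u n ℚ.* seq u n)) ⟨
      ℚ.∣ seq u n ℚ.* seq u n ℚ.- 0ℚ ∣          ∎)))
  where open ℚ.≤-Reasoning

private
  difference : ∀ x y → x ≈ᴿ y → x -ᴿ y ≈ᴿ 0ᴿ
  difference x y x≈y ε ε>0 with L , near ← x≈y ε ε>0 =
    L , λ n L≤n → ≡.subst (λ p → ℚ.∣ p ∣ ℚ.< ε) (≡.sym (sub-0 (seq x n ℚ.- seq y n))) (near n L≤n)

  undifference : ∀ x y → x -ᴿ y ≈ᴿ 0ᴿ → x ≈ᴿ y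
  undifference x y d ε ε>0 with L , near ← d ε ε>0 =
    L , λ n L≤n → ≡.subst (λ p → ℚ.∣ p ∣ ℚ.< ε) (sub-0 (seq x n ℚ.- seq y n)) (near n L≤n)

-- An approximation of a within ¼ decides whether a stays away from 1 or from 0.
ℝ-idempotent : ∀ a → a *ᴿ a ≈ᴿ a → a ≈ᴿ 0ᴿ ⊎ a ≈ᴿ 1ᴿ
ℝ-idempotent a aa≈a = [ inj₁ ∘ low , inj₂ ∘ high ]′ (ℚ.≤-total (seq a M) ½)
  where
  close = isCauchy a ¼ (ℚ.positive⁻¹ ¼)
  M = proj₁ close
  dist : ∀ n → M ℕ.≤ n → ℚ.∣ seq a n ℚ.- seq a M ∣ ℚ.< ¼
  dist n M≤n = proj₂ close (n , M) (ℕ.⊓-glb M≤n ℕ.≤-refl)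
  open +-*-Solver
  vanishing : ∀ n → seq a n ℚ.* (seq a n ℚ.- 1ℚ) ≡ seq a n ℚ.* seq a n ℚ.- seq a n
  vanishing n = solve 1 (λ p → p :* (p :- con 1ℚ) := p :* p :- p) ≡.refl (seq a n)
  product≈0 : a *ᴿ (a -ᴿ 1ᴿ) ≈ᴿ 0ᴿ
  product≈0 = ≈ᴿ-trans {a *ᴿ (a -ᴿ 1ᴿ)} {(a *ᴿ a) -ᴿ a} {0ᴿ}
    (pointwise {a *ᴿ (a -ᴿ 1ᴿ)} {(a *ᴿ a) -ᴿ a} vanishing) (difference (a *ᴿ a) a aa≈a)
  flipped≈0 : (a -ᴿ 1ᴿ) *ᴿ a ≈ᴿ 0ᴿ
  flipped≈0 = ≈ᴿ-trans {(a -ᴿ 1ᴿ) *ᴿ a} {a *ᴿ (a -ᴿ 1ᴿ)} {0ᴿ}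
    (pointwise {(a -ᴿ 1ᴿ) *ᴿ a} {a *ᴿ (a -ᴿ 1ᴿ)} λ n → ℚ.*-comm (seq a n ℚ.- 1ℚ) (seq a n)) product≈0
  p≤∣p∣ : ∀ p → p ℚ.≤ ℚ.∣ p ∣
  p≤∣p∣ p = [ (λ 0≤p → ℚ.≤-reflexive (≡.sym (ℚ.0≤p⇒∣p∣≡p 0≤p))) , (λ p≤0 → ℚ.≤-trans p≤0 (ℚ.0≤∣p∣ p)) ]′
    (ℚ.≤-total 0ℚ p)
  -p≤∣p∣ : ∀ p → ℚ.- p ℚ.≤ ℚ.∣ p ∣
  -p≤∣p∣ p = ≡.subst (ℚ.- p ℚ.≤_) (ℚ.∣-p∣≡∣p∣ p) (p≤∣p∣ (ℚ.- p))
  -- 1 - x = (1 - y) - (x - y) and 1 - y ≥ ½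
  low : seq a M ℚ.≤ ½ → a ≈ᴿ 0ᴿ
  low aM≤½ = *ᴿ-cancel-away a (a -ᴿ 1ᴿ) (M , λ n M≤n → let x = seq a n ; y = seq a M in begin
      ¼                                     ≡⟨⟩
      1ℚ ℚ.- ½ ℚ.- ¼                        ≤⟨ ℚ.+-mono-≤ (ℚ.+-monoʳ-≤ 1ℚ (ℚ.neg-antimono-≤ aM≤½))
                                                 (ℚ.neg-antimono-≤ (ℚ.≤-trans (p≤∣p∣ (x ℚ.- y)) (ℚ.<⇒≤ (dist n M≤n)))) ⟩
      (1ℚ ℚ.- y) ℚ.- (x ℚ.- y)              ≡⟨ solve 2 (λ x y → (con 1ℚ :- y) :- (x :- y) := :- (x :- con 1ℚ)) ≡.refl x y ⟩
      ℚ.- (x ℚ.- 1ℚ)                        ≤⟨ -p≤∣p∣ (x ℚ.- 1ℚ) ⟩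
      ℚ.∣ x ℚ.- 1ℚ ∣                        ∎) product≈0
    where open ℚ.≤-Reasoning
  high : ½ ℚ.≤ seq a M → a ≈ᴿ 1ᴿ
  high ½≤aM = undifference a 1ᴿ (*ᴿ-cancel-away (a -ᴿ 1ᴿ) a (M , λ n M≤n → let x = seq a n ; y = seq a M in begin
      ¼                                     ≡⟨⟩
      ½ ℚ.- ¼                               ≤⟨ ℚ.+-mono-≤ ½≤aM
                                                 (ℚ.neg-antimono-≤ (ℚ.≤-trans (-p≤∣p∣ (x ℚ.- y)) (ℚ.<⇒≤ (dist n M≤n)))) ⟩
      y ℚ.- (ℚ.- (x ℚ.- y))                 ≡⟨ solve 2 (λ x y → y :- (:- (x :- y)) := x) ≡.refl x y ⟩
      x                                     ≤⟨ p≤∣p∣ x ⟩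
      ℚ.∣ x ∣                               ∎) flipped≈0)
    where open ℚ.≤-Reasoning

-- For e = a + bi put P = a² - b² - a and Q = 2ab - b, both zero.  Since (2a - 1)² = 4(P + b²) + 1,
-- one gets b²(1 + 4b²) = Q² - 4b²P = 0, so b = 0 and a is a real idempotent.
ℂ-idempotent : ∀ e → e *ᶜ e ≈ᶜ e → e ≈ᶜ fromℚ 0ℚ ⊎ e ≈ᶜ fromℚ 1ℚ
ℂ-idempotent (a +i b) (re≈ , im≈) =
  [ (λ a≈0 → inj₁ (a≈0 , b≈0)) , (λ a≈1 → inj₂ (a≈1 , b≈0)) ]′ (ℝ-idempotent a aa≈a)
  where
  open +-*-Solver
  4ᴿ P Q bb : ℝ
  4ᴿ = constᴿ (+ 4 / 1)
  P  = ((a *ᴿ a) -ᴿ (b *ᴿ b)) -ᴿ a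
  Q  = ((a *ᴿ b) +ᴿ (b *ᴿ a)) -ᴿ b
  bb = b *ᴿ b
  X Y Z : ℝ
  X = bb *ᴿ (1ᴿ +ᴿ 4ᴿ *ᴿ bb)
  Y = Q *ᴿ Q -ᴿ (4ᴿ *ᴿ bb) *ᴿ P
  Z = 0ᴿ *ᴿ 0ᴿ -ᴿ (4ᴿ *ᴿ bb) *ᴿ 0ᴿ
  P≈0 : P ≈ᴿ 0ᴿ
  P≈0 = difference ((a *ᴿ a) -ᴿ (b *ᴿ b)) a re≈
  Q≈0 : Q ≈ᴿ 0ᴿ
  Q≈0 = difference ((a *ᴿ b) +ᴿ (b *ᴿ a)) b im≈
  X≈Y : X ≈ᴿ Y
  X≈Y = pointwise {X} {Y} λ n → solve 2 (λ a b →
    (b :* b) :* (con 1ℚ :+ con (+ 4 / 1) :* (b :* b)) :=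
    ((a :* b :+ b :* a) :- b) :* ((a :* b :+ b :* a) :- b) :-
    (con (+ 4 / 1) :* (b :* b)) :* ((a :* a :- b :* b) :- a)) ≡.refl (seq a n) (seq b n)
  Y≈Z : Y ≈ᴿ Z
  Y≈Z = +ᴿ-cong {Q *ᴿ Q} {0ᴿ *ᴿ 0ᴿ} { -ᴿ ((4ᴿ *ᴿ bb) *ᴿ P)} { -ᴿ ((4ᴿ *ᴿ bb) *ᴿ 0ᴿ)}
    (*ᴿ-cong {Q} {0ᴿ} {Q} {0ᴿ} Q≈0 Q≈0)
    (-ᴿ-cong {(4ᴿ *ᴿ bb) *ᴿ P} {(4ᴿ *ᴿ bb) *ᴿ 0ᴿ}
      (*ᴿ-cong {4ᴿ *ᴿ bb} {4ᴿ *ᴿ bb} {P} {0ᴿ} (≈ᴿ-refl {4ᴿ *ᴿ bb}) P≈0))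
  Z≈0 : Z ≈ᴿ 0ᴿ
  Z≈0 = pointwise {Z} {0ᴿ} λ n → solve 1 (λ c →
    con 0ℚ :* con 0ℚ :- c :* con 0ℚ := con 0ℚ) ≡.refl (seq (4ᴿ *ᴿ bb) n)
  away : AwayFromZero (1ᴿ +ᴿ 4ᴿ *ᴿ bb)
  away = 0 , λ n _ → let p = seq b n ; r = 1ℚ ℚ.+ (+ 4 / 1) ℚ.* (p ℚ.* p) in begin
    ¼                                     ≤⟨ from-yes (¼ ℚ.≤? 1ℚ) ⟩
    1ℚ                                    ≡⟨ ℚ.+-identityʳ 1ℚ ⟨
    1ℚ ℚ.+ 0ℚ                             ≤⟨ ℚ.+-monoʳ-≤ 1ℚ (0≤4pp p) ⟩
    r                                     ≡⟨ ℚ.0≤p⇒∣p∣≡p (ℚ.+-mono-≤ (ℚ.<⇒≤ (ℚ.positive⁻¹ 1ℚ)) (0≤4pp p)) ⟨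
    ℚ.∣ r ∣                               ∎
    where
    open ℚ.≤-Reasoning
    0≤pp : ∀ p → 0ℚ ℚ.≤ p ℚ.* p
    0≤pp p = ≡.subst (0ℚ ℚ.≤_) (abs-square p) (ℚ.0≤∣p∣ (p ℚ.* p))
      where
      abs-square : ∀ p → ℚ.∣ p ℚ.* p ∣ ≡ p ℚ.* p
      abs-square p with ℚ.∣p∣≡p∨∣p∣≡-p p
      ... | inj₁ eq = ≡.trans (ℚ.∣p*q∣≡∣p∣*∣q∣ p p) (≡.cong₂ ℚ._*_ eq eq)
      ... | inj₂ eq = ≡.trans (ℚ.∣p*q∣≡∣p∣*∣q∣ p p) (≡.trans (≡.cong₂ ℚ._*_ eq eq)
        (solve 1 (λ p → (:- p) :* (:- p) := p :* p) ≡.refl p))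
    0≤4pp : ∀ p → 0ℚ ℚ.≤ (+ 4 / 1) ℚ.* (p ℚ.* p)
    0≤4pp p = ≡.subst (ℚ._≤ (+ 4 / 1) ℚ.* (p ℚ.* p)) (ℚ.*-zeroʳ (+ 4 / 1))
      (ℚ.*-monoˡ-≤-nonNeg (+ 4 / 1) (0≤pp p))
  b≈0 : b ≈ᴿ 0ᴿ
  b≈0 = square≈0 b (*ᴿ-cancel-away bb (1ᴿ +ᴿ 4ᴿ *ᴿ bb) away
    (≈ᴿ-trans {X} {Y} {0ᴿ} X≈Y (≈ᴿ-trans {Y} {Z} {0ᴿ} Y≈Z Z≈0)))
  aa≈a : a *ᴿ a ≈ᴿ a
  aa≈a = ≈ᴿ-trans {a *ᴿ a} {a *ᴿ a -ᴿ 0ᴿ *ᴿ 0ᴿ} {a}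
    (pointwise {a *ᴿ a} {a *ᴿ a -ᴿ 0ᴿ *ᴿ 0ᴿ} λ n → ≡.sym (ℚ.+-identityʳ (seq a n ℚ.* seq a n)))
    (≈ᴿ-trans {a *ᴿ a -ᴿ 0ᴿ *ᴿ 0ᴿ} {a *ᴿ a -ᴿ b *ᴿ b} {a}
      (+ᴿ-cong {a *ᴿ a} {a *ᴿ a} { -ᴿ (0ᴿ *ᴿ 0ᴿ)} { -ᴿ (b *ᴿ b)} (≈ᴿ-refl {a *ᴿ a})
        (-ᴿ-cong {0ᴿ *ᴿ 0ᴿ} {b *ᴿ b} (*ᴿ-cong {0ᴿ} {b} {0ᴿ} {b} 0≈b 0≈b)))
      re≈)
    where
    0≈b : 0ᴿ ≈ᴿ b
    0≈b = ≈ᴿ-sym {b} {0ᴿ} b≈0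

ℂ-isScalarRing : IsScalarRing ℂ-commutativeRing
ℂ-isScalarRing = record
  { 1≉0        = λ (1≈0 , _) → let L , near = 1≈0 ½ (ℚ.positive⁻¹ ½) in
                   ℚ.<-asym (near L ℕ.≤-refl) (from-yes (½ ℚ.<? 1ℚ))
  ; idempotent = ℂ-idempotent
  ; -1/        = λ n → fromℚ (-1ℤ / n)
  ; -1/-*      = reciprocal
  }
  where
  open RawMonoidOps (CommutativeRing.+-rawMonoid ℂ-commutativeRing) using () renaming (_×_ to _·_)
  open +-*-Solver
  re-·1 : ∀ n k → seq (re (n · fromℚ 1ℚ)) k ≡ + n / 1
  re-·1 zero    k = ≡.refl
  re-·1 (suc n) k = ≡.trans (≡.cong (1ℚ ℚ.+_) (re-·1 n k)) (/-+ (+ 1) (+ n) 1)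
  im-·1 : ∀ n k → seq (im (n · fromℚ 1ℚ)) k ≡ 0ℚ
  im-·1 zero    k = ≡.refl
  im-·1 (suc n) k = ≡.cong (0ℚ ℚ.+_) (im-·1 n k)
  reciprocal : ∀ n .{{_ : NonZero n}} → fromℚ (-1ℤ / n) *ᶜ (n · fromℚ 1ℚ) ≈ᶜ -ᶜ fromℚ 1ℚ
  reciprocal n =
    pointwise {re z} {re w} (λ k → ≡.trans
      (≡.cong₂ (λ p r → (-1ℤ / n) ℚ.* p ℚ.- 0ℚ ℚ.* r) (re-·1 n k) (im-·1 n k))
      (≡.trans (ℚ.+-identityʳ _) (-1/-*-/1 n))) ,
    pointwise {im z} {im w} (λ k → ≡.trans
      (≡.cong₂ (λ p r → (-1ℤ / n) ℚ.* r ℚ.+ 0ℚ ℚ.* p) (re-·1 n k) (im-·1 n k))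
      (solve 2 (λ p r → p :* con 0ℚ :+ con 0ℚ :* r := con 0ℚ) ≡.refl (-1ℤ / n) (+ n / 1)))
    where
    z = fromℚ (-1ℤ / n) *ᶜ (n · fromℚ 1ℚ)
    w = -ᶜ fromℚ 1ℚ

-- Integer powers and generators of the character group

module Powers {a ℓ} (A : AbelianGroup a ℓ) where
  open AbelianGroup A
  open AbelianGroupProperties A
  open CommutativeSemigroupProperties commutativeSemigroup using (x∙yz≈y∙xz)
  open CommutativeMonoidMult commutativeMonoid using (×-congʳ; ×-distrib-+) renaming (_×_ to _times_)
  open SetoidReasoning setoid

  infixr 8 _^^_
  _^^_ : Carrier → ℤ → Carrier
  _^^_ = power group

  ^^-cong : ∀ i {x y} → x ≈ y → x ^^ i ≈ y ^^ i
  ^^-cong (+ n)    x≈y = ×-congʳ n x≈y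
  ^^-cong -[1+ n ] x≈y = ⁻¹-cong (×-congʳ (suc n) x≈y)

  ^^-∙ : ∀ i x y → (x ∙ y) ^^ i ≈ x ^^ i ∙ y ^^ i
  ^^-∙ (+ n)    x y = ×-distrib-+ x y n
  ^^-∙ -[1+ n ] x y = trans (⁻¹-cong (×-distrib-+ x y (suc n))) (sym (⁻¹-∙-comm _ _))

  ^^-ε : ∀ i → ε ^^ i ≈ ε
  ^^-ε i = identityˡ-unique (ε ^^ i) (ε ^^ i)
    (trans (sym (^^-∙ i ε ε)) (^^-cong i (identityˡ ε)))

  ^^-⁻¹ : ∀ i x → (x ⁻¹) ^^ i ≈ (x ^^ i) ⁻¹
  ^^-⁻¹ i x = inverseˡ-unique _ _
    (trans (sym (^^-∙ i (x ⁻¹) x)) (trans (^^-cong i (inverseˡ x)) (^^-ε i)))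

  ^^-suc : ∀ i x → x ^^ ℤ.suc i ≈ x ∙ x ^^ i
  ^^-suc (+ n)        x = refl
  ^^-suc -[1+ zero ]  x = begin
    ε                      ≈⟨ inverseʳ x ⟨
    x ∙ x ⁻¹               ≈⟨ ∙-congˡ (⁻¹-cong (identityʳ x)) ⟨
    x ∙ (x ∙ ε) ⁻¹         ∎
  ^^-suc -[1+ suc n ] x = begin
    (suc n times x) ⁻¹                ≈⟨ //-rightDividesˡ x _ ⟨
    (suc n times x) ⁻¹ ∙ x ⁻¹ ∙ x     ≈⟨ comm _ x ⟩
    x ∙ ((suc n times x) ⁻¹ ∙ x ⁻¹)   ≈⟨ ∙-congˡ (⁻¹-anti-homo-∙ x (suc n times x)) ⟨
    x ∙ (x ∙ suc n times x) ⁻¹        ∎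

  ^^-pred : ∀ i x → x ^^ ℤ.pred i ≈ x ⁻¹ ∙ x ^^ i
  ^^-pred i x = ∙-cancelˡ x _ _ (begin
    x ∙ x ^^ ℤ.pred i        ≈⟨ ^^-suc (ℤ.pred i) x ⟨
    x ^^ ℤ.suc (ℤ.pred i)    ≡⟨ ≡.cong (x ^^_) (ℤ.suc-pred i) ⟩
    x ^^ i                   ≈⟨ \\-leftDividesˡ x _ ⟨
    x ∙ (x ⁻¹ ∙ x ^^ i)      ∎)

  ^^-+ : ∀ i j x → x ^^ (i ℤ.+ j) ≈ x ^^ i ∙ x ^^ j
  ^^-+ (+ zero) j x = trans (reflexive (≡.cong (x ^^_) (ℤ.+-identityˡ j))) (sym (identityˡ _))
  ^^-+ (+ suc n) j x = begin
    x ^^ (+ suc n ℤ.+ j)          ≡⟨ ≡.cong (x ^^_) (ℤ.suc-+ n j) ⟩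
    x ^^ ℤ.suc (+ n ℤ.+ j)        ≈⟨ ^^-suc (+ n ℤ.+ j) x ⟩
    x ∙ x ^^ (+ n ℤ.+ j)          ≈⟨ ∙-congˡ (^^-+ (+ n) j x) ⟩
    x ∙ (x ^^ + n ∙ x ^^ j)       ≈⟨ assoc _ _ _ ⟨
    x ^^ + suc n ∙ x ^^ j         ∎
  ^^-+ -[1+ n ] j x = begin
    x ^^ (-[1+ n ] ℤ.+ j)         ≡⟨ ≡.cong (λ i → x ^^ (i ℤ.+ j)) (pred-neg n) ⟩
    x ^^ (ℤ.pred (ℤ.- (+ n)) ℤ.+ j)
                                  ≡⟨ ≡.cong (x ^^_) (ℤ.pred-+ (ℤ.- (+ n)) j) ⟩
    x ^^ ℤ.pred (ℤ.- (+ n) ℤ.+ j) ≈⟨ ^^-pred (ℤ.- (+ n) ℤ.+ j) x ⟩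
    x ⁻¹ ∙ x ^^ (ℤ.- (+ n) ℤ.+ j) ≈⟨ ∙-congˡ (ih n) ⟩
    x ⁻¹ ∙ (x ^^ (ℤ.- (+ n)) ∙ x ^^ j)
                                  ≈⟨ assoc _ _ _ ⟨
    x ⁻¹ ∙ x ^^ (ℤ.- (+ n)) ∙ x ^^ j
                                  ≈⟨ ∙-congʳ (^^-pred (ℤ.- (+ n)) x) ⟨
    x ^^ ℤ.pred (ℤ.- (+ n)) ∙ x ^^ j
                                  ≡⟨ ≡.cong (λ i → x ^^ i ∙ x ^^ j) (pred-neg n) ⟨
    x ^^ -[1+ n ] ∙ x ^^ j        ∎
    where
    pred-neg : ∀ n → -[1+ n ] ≡ ℤ.pred (ℤ.- (+ n))
    pred-neg zero    = ≡.refl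
    pred-neg (suc n) = ≡.refl
    -- The split on n is needed because -n is `+ 0` or `-[1+_]`, and only then does the recursive
    -- call see a constructor.
    ih : ∀ n → x ^^ (ℤ.- (+ n) ℤ.+ j) ≈ x ^^ (ℤ.- (+ n)) ∙ x ^^ j
    ih zero    = ^^-+ (+ zero) j x
    ih (suc n) = ^^-+ -[1+ n ] j x

  -- Makes the powers of ω available as characters, so that the generator hypothesis can be applied
  -- to them.
  powerHomomorphism : ∀ {g ℓg} {G : Group g ℓg} →
    GroupHomomorphism (Group.rawGroup G) rawGroup → ℤ → GroupHomomorphism (Group.rawGroup G) rawGroup
  powerHomomorphism φ i = record
    { ⟦_⟧ = λ x → φ.⟦ x ⟧ ^^ i
    ; isGroupHomomorphism = record
      { isMonoidHomomorphism = record
        { isMagmaHomomorphism = record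
          { isRelHomomorphism = record { cong = λ x≈y → ^^-cong i (φ.⟦⟧-cong x≈y) }
          ; homo = λ x y → trans (^^-cong i (φ.homo x y)) (^^-∙ i _ _)
          }
        ; ε-homo = trans (^^-cong i φ.ε-homo) (^^-ε i)
        }
      ; ⁻¹-homo = λ x → trans (^^-cong i (φ.⁻¹-homo x)) (^^-⁻¹ i _)
      }
    }
    where module φ = GroupHomomorphism φ

-- `IsGenerator` with ℂˣ replaced by a variable abelian group; at ℂˣ the two agree definitionally.
Generates : ∀ {g ℓg a ℓ} (N : ℕ) {G : Group g ℓg} (A : AbelianGroup a ℓ) →
            GroupHomomorphism (Group.rawGroup G) (AbelianGroup.rawGroup A) → Set (g ⊔ ℓg ⊔ a ⊔ ℓ)
Generates N {G} A ω = ∀ (χ : GroupHomomorphism (Group.rawGroup G) (AbelianGroup.rawGroup A)) →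
  ∃! _≡_ λ (j : Fin N) → ∀ x →
    ⟦ χ ⟧ x ≈ power group (⟦ ω ⟧ x) (+ toℕ j)
  where
  open AbelianGroup A
  open GroupHomomorphism using (⟦_⟧)

module Generators {g ℓg a ℓ N} .{{_ : NonZero N}} {G : Group g ℓg} (A : AbelianGroup a ℓ)
    (ω : GroupHomomorphism (Group.rawGroup G) (AbelianGroup.rawGroup A))
    (generates : Generates N {G} A ω) where
  open AbelianGroup A
  private module ω = GroupHomomorphism ω
  open Powers A
  open AbelianGroupProperties A using (identityˡ-unique)
  open SetoidReasoning setoid

  0′ : Fin N
  0′ = fromℕ< (ℕ.>-nonZero⁻¹ N)

  toℕ-0′ : toℕ 0′ ≡ 0
  toℕ-0′ = Fin.toℕ-fromℕ< _

  -- Both j and 0 represent the trivial character ω^0, and the exponent of a character is unique.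
  ω-faithful : ∀ (j : Fin N) → (∀ x → ω.⟦ x ⟧ ^^ (+ toℕ j) ≈ ε) → toℕ j ≡ 0
  ω-faithful j trivial with j₀ , _ , unique ← generates (powerHomomorphism {G = G} ω (+ 0)) =
    ≡.trans (≡.cong toℕ (≡.trans (≡.sym (unique λ x → sym (trivial x)))
                                 (unique λ x → reflexive (≡.cong (λ m → ω.⟦ x ⟧ ^^ (+ m)) (≡.sym toℕ-0′)))))
            toℕ-0′

  -- Write ω^N = ω^j with j < N; if j > 0 then N - j < N and ω^{N-j} is trivial, against uniqueness.
  ω-period : ∀ x → ω.⟦ x ⟧ ^^ (+ N) ≈ ε
  ω-period with j , ω^N≈ω^j , _ ← generates (powerHomomorphism {G = G} ω (+ N)) =
    λ x → by-cases (toℕ j) (Fin.toℕ<n j) ω^N≈ω^j x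
    where
    by-cases : ∀ m → m ℕ.< N → (∀ x → ω.⟦ x ⟧ ^^ (+ N) ≈ ω.⟦ x ⟧ ^^ (+ m)) →
               ∀ x → ω.⟦ x ⟧ ^^ (+ N) ≈ ε
    by-cases zero    _   eq x = eq x
    by-cases (suc m) m<N eq _ = contradiction N-m≡0 (ℕ.m>n⇒m∸n≢0 m<N)
      where
      d = N ∸ suc m
      d<N : d ℕ.< N
      d<N = ℕ.∸-monoʳ-< {N} {suc m} {0} ℕ.z<s (ℕ.<⇒≤ m<N)
      trivial : ∀ x → ω.⟦ x ⟧ ^^ (+ d) ≈ ε
      trivial x = identityˡ-unique (ω.⟦ x ⟧ ^^ (+ d)) (ω.⟦ x ⟧ ^^ (+ suc m)) (begin
        ω.⟦ x ⟧ ^^ (+ d) ∙ ω.⟦ x ⟧ ^^ (+ suc m)   ≈⟨ ^^-+ (+ d) (+ suc m) ω.⟦ x ⟧ ⟨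
        ω.⟦ x ⟧ ^^ (+ (d ℕ.+ suc m))              ≡⟨ ≡.cong (λ n → ω.⟦ x ⟧ ^^ (+ n)) (ℕ.m∸n+n≡m (ℕ.<⇒≤ m<N)) ⟩
        ω.⟦ x ⟧ ^^ (+ N)                          ≈⟨ eq x ⟩
        ω.⟦ x ⟧ ^^ (+ suc m)                      ∎)
      N-m≡0 : d ≡ 0
      N-m≡0 = ≡.trans (≡.sym (Fin.toℕ-fromℕ< d<N))
        (ω-faithful (fromℕ< d<N) λ x →
          ≡.subst (λ n → ω.⟦ x ⟧ ^^ (+ n) ≈ ε) (≡.sym (Fin.toℕ-fromℕ< d<N)) (trivial x))

-- A plays the role of units K; being a variable, it keeps the invertibility proofs inside ℂˣ from
-- being unfolded when K = ℂ.
module GeneratorFamily {k ℓk c ℓ q a ℓa} {K : CommutativeRing k ℓk} {F : FiniteField c ℓ q}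
    (A : AbelianGroup a ℓa)
    (ι : AbelianGroup.Carrier A → CommutativeRing.Carrier K)
    (ι-cong : ∀ {u v} → AbelianGroup._≈_ A u v → CommutativeRing._≈_ K (ι u) (ι v))
    (ι-ε : CommutativeRing._≈_ K (ι (AbelianGroup.ε A)) (CommutativeRing.1# K))
    (ι-∙ : ∀ u v → CommutativeRing._≈_ K (ι (AbelianGroup._∙_ A u v)) (CommutativeRing._*_ K (ι u) (ι v)))
    (ι-injective-ε : ∀ {u} → CommutativeRing._≈_ K (ι u) (CommutativeRing.1# K) →
                     AbelianGroup._≈_ A u (AbelianGroup.ε A))
    (ω : GroupHomomorphism (Group.rawGroup (Characters.Fˣ F)) (AbelianGroup.rawGroup A))
    (generates : Generates (q ∸ 1) {Characters.Fˣ F} A ω)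
    (W : ℤ → FiniteField.Carrier F → CommutativeRing.Carrier K)
    (W-zero : ∀ i {x} → FiniteField._≈_ F x (FiniteField.0# F) → W i x ≡ CommutativeRing.0# K)
    (W-nonzero : ∀ i {x} → ¬ FiniteField._≈_ F x (FiniteField.0# F) →
      ∃[ x≉0 ] W i x ≡
        ι (power (AbelianGroup.group A)
                 (GroupHomomorphism.⟦_⟧ ω (x , FiniteField.invertible F x x≉0)) i)) where
  private
    module K = CommutativeRing K
    module F = FiniteField F
    module A = AbelianGroup A
    module ω = GroupHomomorphism ω
  open Characters F using (Fˣ)
  open Powers A
  open Generators {G = Fˣ} A ω generates

  W-≈0 : ∀ i {x} → x F.≈ F.0# → W i x K.≈ K.0#
  W-≈0 i x≈0 = K.reflexive (W-zero i x≈0)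

  unit≉0 : (u : Group.Carrier Fˣ) → ¬ proj₁ u F.≈ F.0#
  unit≉0 (x , y , yx≈1 , _) x≈0 =
    F.0≉1 (F.trans (F.sym (F.zeroʳ y)) (F.trans (F.*-congˡ (F.sym x≈0)) yx≈1))

  -- ω respects equality of underlying elements, so the inverse chosen by `invertible` may be
  -- exchanged for the one stored in u.
  W-unit : ∀ i (u : Group.Carrier Fˣ) → W i (proj₁ u) K.≈ ι (ω.⟦ u ⟧ ^^ i)
  W-unit i u@(x , _) = let x≉0 , eq = W-nonzero i (unit≉0 u) in
    K.trans (K.reflexive eq) (ι-cong (^^-cong i (ω.⟦⟧-cong {x , F.invertible x x≉0} {u} F.refl)))

  isCharacterFamily : IsCharacterFamily K F W
  isCharacterFamily = record
    { W-cong     = W-cong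
    ; W-at-0     = λ i → W-≈0 i F.refl
    ; W-*        = W-*
    ; W-+        = W-+
    ; W-0        = λ x x≉0 → K.trans (W-unit (+ 0) (unit x≉0)) ι-ε
    ; W-period   = λ x x≉0 → K.trans (W-unit (+ (q ∸ 1)) (unit x≉0))
                               (K.trans (ι-cong (ω-period (unit x≉0))) ι-ε)
    ; W-faithful = λ j trivial → ω-faithful j λ u →
        ι-injective-ε (K.trans (K.sym (W-unit (+ toℕ j) u)) (trivial (proj₁ u) (unit≉0 u)))
    }
    where
    unit : ∀ {x} → ¬ x F.≈ F.0# → Group.Carrier Fˣ
    unit {x} x≉0 = x , F.invertible x x≉0
    W-cong : ∀ i {x y} → x F.≈ y → W i x K.≈ W i y
    W-cong i {x} {y} x≈y with x F.≟ F.0#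
    ... | yes x≈0 = K.trans (W-≈0 i x≈0) (K.sym (W-≈0 i (F.trans (F.sym x≈y) x≈0)))
    ... | no  x≉0 = K.trans (W-unit i u) (K.trans (ι-cong (^^-cong i (ω.⟦⟧-cong {u} {v} x≈y))) (K.sym (W-unit i v)))
      where
      u = unit x≉0
      v = unit λ y≈0 → x≉0 (F.trans x≈y y≈0)
    W-* : ∀ i x y → W i (x F.* y) K.≈ W i x K.* W i y
    W-* i x y with x F.≟ F.0# | y F.≟ F.0#
    ... | yes x≈0 | _ = K.trans (W-≈0 i (F.trans (F.*-congʳ x≈0) (F.zeroˡ y)))
                          (K.sym (K.trans (K.*-congʳ (W-≈0 i x≈0)) (K.zeroˡ _)))
    ... | no  _   | yes y≈0 = K.trans (W-≈0 i (F.trans (F.*-congˡ y≈0) (F.zeroʳ x)))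
                          (K.sym (K.trans (K.*-congˡ (W-≈0 i y≈0)) (K.zeroʳ _)))
    ... | no  x≉0 | no y≉0 = K.trans (W-unit i (Group._∙_ Fˣ u v))
        (K.trans (ι-cong (A.trans (^^-cong i (ω.homo u v)) (^^-∙ i ω.⟦ u ⟧ ω.⟦ v ⟧)))
          (K.trans (ι-∙ _ _) (K.sym (K.*-cong (W-unit i u) (W-unit i v)))))
      where
      u = unit x≉0
      v = unit y≉0
    W-+ : ∀ i j x → W (i ℤ.+ j) x K.≈ W i x K.* W j x
    W-+ i j x with x F.≟ F.0#
    ... | yes x≈0 = K.trans (W-≈0 (i ℤ.+ j) x≈0)
                      (K.sym (K.trans (K.*-congʳ (W-≈0 i x≈0)) (K.zeroˡ _)))
    ... | no  x≉0 = K.trans (W-unit (i ℤ.+ j) u)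
        (K.trans (K.trans (ι-cong (^^-+ i j ω.⟦ u ⟧)) (ι-∙ _ _)) (K.sym (K.*-cong (W-unit i u) (W-unit j u))))
      where u = unit x≉0

-- Nondegenerate parameters and the specialisation to ℂ

-- Nondegeneracy speaks of β - α while the denominators carry α - β, so the integer found is -d.
multiple⇒IsInteger : ∀ {N} .{{_ : NonZero N}} (μ ν : Frac N) d → num (μ ⊖ ν) ≡ d ℤ.* + N →
                     IsInteger (toℚ ν ℚ.- toℚ μ)
multiple⇒IsInteger {N} μ ν d eq = ℤ.- d , (begin
  num ν / N ℚ.- num μ / N             ≡⟨ ≡.cong (num ν / N ℚ.+_) (/-neg (num μ) N) ⟩
  num ν / N ℚ.+ (ℤ.- num μ) / N       ≡⟨ /-+ (num ν) (ℤ.- num μ) N ⟩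
  (num ν ℤ.+ ℤ.- num μ) / N           ≡⟨ ≡.cong (_/ N) (≡.trans (swap (num ν) (num μ)) (≡.cong ℤ.-_ eq)) ⟩
  (ℤ.- (d ℤ.* + N)) / N               ≡⟨ ≡.cong (_/ N) (ℤ.neg-distribˡ-* d (+ N)) ⟩
  (ℤ.- d ℤ.* + N) / N                 ≡⟨ /-cancel (ℤ.- d) N ⟩
  (ℤ.- d) / 1                         ∎)
  where
  open ≡.≡-Reasoning
  swap : ∀ i j → i ℤ.+ ℤ.- j ≡ ℤ.- (j ℤ.+ ℤ.- i)
  swap = solve-∀

module ComplexCharacters {c ℓ q} (F : FiniteField c ℓ q)
    (ω : Characters.MultiplicativeCharacter F) (generator : Characters.IsGenerator F ω)
    (Θ : Characters.AdditiveCharacter F) (nontrivial : Characters.Nontrivial F Θ) where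
  open FiniteField F
  open GroupHomomorphism using (⟦_⟧)
  private
    module ω = GroupHomomorphism ω
    module Θ = GroupHomomorphism Θ
    module ℂ-ring = CommutativeRing ℂ-commutativeRing

  ℂˣ-abelian : AbelianGroup _ _
  ℂˣ-abelian = record
    { isAbelianGroup = record
      { isGroup = Group.isGroup ℂˣ
      ; comm = λ u v → ℂ-ring.*-comm (proj₁ u) (proj₁ v)
      }
    }

  W-zero : ∀ i {x} → x ≈ 0# → Characters.Sums.ω^ F ω Θ (i /N) x ≡ fromℚ 0ℚ
  W-zero i {x} x≈0 with x ≟ 0#
  ... | yes _  = ≡.refl
  ... | no x≉0 = contradiction x≈0 x≉0

  -- Existential because `ω^` uses the proof of x ≠ 0 produced by its own decision, which need not
  -- be the given one.
  W-nonzero : ∀ i {x} → ¬ x ≈ 0# →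
    ∃[ x≉0 ] Characters.Sums.ω^ F ω Θ (i /N) x ≡ proj₁ (power ℂˣ (⟦ ω ⟧ (x , invertible x x≉0)) i)
  W-nonzero i {x} x≉0 with x ≟ 0#
  ... | yes x≈0 = contradiction x≈0 x≉0
  ... | no x≉0′ = x≉0′ , ≡.refl

  family : IsCharacterFamily ℂ-commutativeRing F (λ i → Characters.Sums.ω^ F ω Θ (i /N))
  family = GeneratorFamily.isCharacterFamily {K = ℂ-commutativeRing} {F = F} ℂˣ-abelian
    proj₁ (λ u≈v → u≈v) (ℂ-ring.refl {fromℚ 1ℚ}) (λ u v → ℂ-ring.refl {proj₁ u *ᶜ proj₁ v}) (λ u≈1 → u≈1)
    ω generator (λ i → Characters.Sums.ω^ F ω Θ (i /N)) W-zero W-nonzero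

  additive : IsAdditiveCharacter ℂ-commutativeRing F (λ x → proj₁ (⟦ Θ ⟧ x))
  additive = record
    { T-cong       = Θ.⟦⟧-cong
    ; T-+          = Θ.homo
    ; T-0          = Θ.ε-homo
    ; T-nontrivial = nontrivial
    }

  open MultiplicativeCharacters ℂ-isScalarRing family using (Trivial; Trivial⇒multiple)
  open HypergeometricSums ℂ-isScalarRing {ω^ = Characters.Sums.ω^ F ω Θ} family additive

  nondegenerate⇒nontrivial : ∀ {n} (α β : Fin n → Frac (q ∸ 1)) → Nondegenerate α β →
                             ∀ i → ¬ Trivial (num (α i ⊖ β i))
  nondegenerate⇒nontrivial α β nondegenerate i trivial =
    let d , eq = Trivial⇒multiple (num (α i ⊖ β i)) trivial in
    nondegenerate i (multiple⇒IsInteger (α i) (β i) d eq)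

  module _ {n} (α β : Fin n → Frac (q ∸ 1)) (nondegenerate : Nondegenerate α β) where

    denominator-unit : ∀ i → IsUnitᶜ (Characters.Sums.g F ω Θ (α i ⊖ β i))
    denominator-unit i =
      gauss-isUnit _*ᶜ_ (λ n → sumᶜ {n}) (λ n → prodᶜ {n}) (fromℚ 0ℚ)
        (Characters.sumOver F (Characters.nonzero? F)) (Characters.Sums.g F ω Θ)
        ≡.refl ≡.refl ≡.refl (λ _ → ≡.refl) (λ _ → ≡.refl)
        (α i ⊖ β i) (nondegenerate⇒nontrivial α β nondegenerate i)

    hypersurface-sum : ∀ t {φ : (Fin n → Carrier) → Fin n → ℂ} →
      (∀ x i → φ x i ≈ᶜ Characters.Sums.ω^ F ω Θ (α i) (- x i) *ᶜ
                        Characters.Sums.ω^ F ω Θ (β i ⊖ α i) (1# - x i)) →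
      Characters.sumTuplesOver F (Characters.onHypersurface? F t) (λ x → prodᶜ (φ x)) ≈ᶜ
      -ᶜ Characters.Sums.H F ω Θ α β denominator-unit t
    hypersurface-sum t {φ} φ≈ =
      hypersurface-formula _*ᶜ_ (λ n → sumᶜ {n}) (λ n → prodᶜ {n}) (fromℚ 0ℚ)
        (Characters.sumOver F (Characters.nonzero? F)) (Characters.Sums.g F ω Θ)
        ≡.refl ≡.refl ≡.refl ≡.refl (λ _ → ≡.refl) (λ _ → ≡.refl)
        (Characters.sumTuples F) (λ _ → ≡.refl) (λ _ _ → ≡.refl)
        α β (nondegenerate⇒nontrivial α β nondegenerate) denominator-unit t φ φ≈
        (Characters.Sums.H F ω Θ α β denominator-unit t) _
        (ℂ-ring.refl {Characters.Sums.H F ω Θ α β denominator-unit t}) refl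

proposition4p5p1 : ∀ {c ℓ : Level} (q : ℕ) → PrimePower q → (F : FiniteField c ℓ q) →
    let open FiniteField F
        open Characters F in
    (ω : MultiplicativeCharacter) → IsGenerator ω →
    (Θ : AdditiveCharacter) → Nontrivial Θ →
    let open Sums ω Θ in
    (n : ℕ) → 1 ≤ n → (α β : Fin n → Frac (q ∸ 1)) → Nondegenerate α β →
    (t : Carrier) → ¬ t ≈ 0# → ¬ t ≈ 1# →
    Σ (∀ i → IsUnitᶜ (g (α i ⊖ β i))) λ u →
      sumTuplesOver (onHypersurface? t)
        (λ x → prodᶜ λ i → ω^ (α i) (- x i) *ᶜ ω^ (β i ⊖ α i) (1# - x i))
      ≈ᶜ -ᶜ H α β u t
proposition4p5p1 q _ F ω generator Θ nontrivial n _ α β nondegenerate t _ _ =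
  denominator-unit α β nondegenerate ,
  -- Splitting the pair infers φ once per component: the solution found for the real part is
  -- partly normalised, and would no longer match the goal syntactically in the imaginary part.
  proj₁ (hypersurface-sum α β nondegenerate t integrand-refl) ,
  proj₂ (hypersurface-sum α β nondegenerate t integrand-refl)
  where
  open FiniteField F
  open ComplexCharacters F ω generator Θ nontrivial
  integrand : (Fin n → Carrier) → Fin n → ℂ
  integrand x i =
    Characters.Sums.ω^ F ω Θ (α i) (- x i) *ᶜ Characters.Sums.ω^ F ω Θ (β i ⊖ α i) (1# - x i)
  integrand-refl : ∀ x i → integrand x i ≈ᶜ integrand x i
  integrand-refl x i = CommutativeRing.refl ℂ-commutativeRing {integrand x i}
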